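{- Derivability of judgments $\Gamma \rhd \rho \dashv \sigma$ (with $\Gamma$ a finite set of expressions $\rho'\dashv\sigma'$ and $\rho,\sigma$ retractable contracts) in the formal system for compliance described in the context is decidable.
   Context: Let $\mathcal N$ be a countable set of names and $\overline{\mathcal N}=\{\overline a\mid a\in\mathcal N\}$ a disjoint set of conames. Retractable contracts are the closed expressions generated by $\sigma,\rho ::= \mathbf 1 \mid \sum_{i\in I} a_i.\sigma_i \mid \sum_{i\in I}\overline a_i.\sigma_i \mid \bigoplus_{i\in I}\overline a_i.\sigma_i \mid x \mid \mathsf{rec}\,x.\sigma$ (success, input, retractable output, unretractable output, variable, recursion), where $I$ is non-empty and finite, the names/conames in each choice are pairwise distinct, and in $\mathsf{rec}\,x.\sigma$, $\sigma$ is not a variable. Recursion is equi-recursive: $\mathsf{rec}\,x.\sigma$ is identified with $\sigma[\mathsf{rec}\,x.\sigma/x]$; sums and $\oplus$ are commutative; a unary retractable output and a unary unretractable output $\overline a.\sigma$ are identified. Let $\alpha$ range over $\mathcal N\cup\overline{\mathcal N}$ with $\overline{\overline a}=a$. Judgments have the form $\Gamma\rhd\rho\dashv\sigma$ with $\Gamma$ a set of expressions $\rho'\dashv\sigma'$. The rules are: (Ax) $\Gamma\rhd \mathbf 1\dashv\sigma$; (Hyp) $\Gamma,\rho\dashv\sigma\rhd\rho\dashv\sigma$; (+,+) from $\Gamma,\ \alpha.\rho+\rho'\dashv\overline\alpha.\sigma+\sigma' \rhd \rho\dashv\sigma$ infer $\Gamma\rhd \alpha.\rho+\rho'\dashv\overline\alpha.\sigma+\sigma'$;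 $(\oplus,+)$ from $\Gamma,\ \bigoplus_{i\in I}\overline a_i.\rho_i\dashv\sum_{j\in I\cup J}a_j.\sigma_j\rhd\rho_i\dashv\sigma_i$ for all $i\in I$, infer $\Gamma\rhd\bigoplus_{i\in I}\overline a_i.\rho_i\dashv\sum_{j\in I\cup J}a_j.\sigma_j$; $(+,\oplus)$ from $\Gamma,\ \sum_{j\in I\cup J}a_j.\sigma_j\dashv\bigoplus_{i\in I}\overline a_i.\rho_i\rhd\rho_i\dashv\sigma_i$ for all $i\in I$, infer $\Gamma\rhd\sum_{j\in I\cup J}a_j.\sigma_j\dashv\bigoplus_{i\in I}\overline a_i.\rho_i$. Derivations are finite trees; contracts are considered modulo recursion fold/unfold. -}

module Defs where

open import Data.Nat using (ℕ; zero; suc)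
open import Data.Fin using (Fin; zero; suc)
open import Data.List using (List; []; _∷_; [_]; map)
open import Data.List.Relation.Unary.All using (All)
open import Data.List.Relation.Unary.Unique.Propositional using (Unique)
open import Data.List.Membership.Propositional using (_∈_)
open import Data.List.Relation.Binary.Permutation.Propositional using (_↭_)
open import Data.Product using (_×_; _,_; proj₁; proj₂; ∃-syntax)
open import Data.Empty using (⊥)
open import Data.Unit using (⊤)
open import Relation.Binary.PropositionalEquality using (_≡_)

-- Names are natural numbers; conames are represented by a polarity tag.
Name : Set
Name = ℕ

-- Polarity of a sum: inp = input sum  Σ a_i.σ_i,
--                    out = retractable output sum  Σ ā_i.σ_i.
data Pol : Set where
  inp out : Pol

dual : Pol → Pol
dual inp = out
dual out = inp

data Contract (n : ℕ) : Set where
  𝟏   : Contract n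
  Σ⟨_⟩ : Pol → List (Name × Contract n) → Contract n
  ⊕   : List (Name × Contract n) → Contract n        -- unretractable output (conames)
  var : Fin n → Contract n
  rec : Contract (suc n) → Contract n

liftR : ∀ {n m} → (Fin n → Fin m) → Fin (suc n) → Fin (suc m)
liftR f zero = zero
liftR f (suc i) = suc (f i)

mutual
  ren : ∀ {n m} → (Fin n → Fin m) → Contract n → Contract m
  ren f 𝟏 = 𝟏
  ren f (Σ⟨ p ⟩ L) = Σ⟨ p ⟩ (renL f L)
  ren f (⊕ L) = ⊕ (renL f L)
  ren f (var i) = var (f i)
  ren f (rec b) = rec (ren (liftR f) b)

  renL : ∀ {n m} → (Fin n → Fin m) → List (Name × Contract n) → List (Name × Contract m)
  renL f [] = []
  renL f ((a , c) ∷ L) = (a , ren f c) ∷ renL f L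

liftS : ∀ {n m} → (Fin n → Contract m) → Fin (suc n) → Contract (suc m)
liftS s zero = var zero
liftS s (suc i) = ren suc (s i)

mutual
  sub : ∀ {n m} → (Fin n → Contract m) → Contract n → Contract m
  sub s 𝟏 = 𝟏
  sub s (Σ⟨ p ⟩ L) = Σ⟨ p ⟩ (subL s L)
  sub s (⊕ L) = ⊕ (subL s L)
  sub s (var i) = s i
  sub s (rec b) = rec (sub (liftS s) b)

  subL : ∀ {n m} → (Fin n → Contract m) → List (Name × Contract n) → List (Name × Contract m)
  subL s [] = []
  subL s ((a , c) ∷ L) = (a , sub s c) ∷ subL s L

unfoldBody : ∀ {n} → Contract (suc n) → Contract n
unfoldBody {n} b = sub s b
  where
  s : Fin (suc n) → Contract n
  s zero = rec b
  s (suc i) = var i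

IsVar : ∀ {n} → Contract n → Set
IsVar (var _) = ⊤
IsVar _ = ⊥

data NonEmpty {A : Set} : List A → Set where
  nonEmpty : ∀ {x xs} → NonEmpty (x ∷ xs)

mutual
  data WF : ∀ {n} → Contract n → Set where
    wf-𝟏   : ∀ {n} → WF {n} 𝟏
    wf-Σ   : ∀ {n p} {L : List (Name × Contract n)} → WFChoice L → WF (Σ⟨ p ⟩ L)
    wf-⊕   : ∀ {n} {L : List (Name × Contract n)} → WFChoice L → WF (⊕ L)
    wf-var : ∀ {n} {i : Fin n} → WF (var i)
    wf-rec : ∀ {n} {b : Contract (suc n)} → (IsVar b → ⊥) → WF b → WF (rec b)

  data WFChoice {n : ℕ} (L : List (Name × Contract n)) : Set where
    wfChoice : NonEmpty L → Unique (map proj₁ L) → WFAll L → WFChoice L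

  data WFAll {n : ℕ} : List (Name × Contract n) → Set where
    [] : WFAll []
    _∷_ : ∀ {a c L} → WF c → WFAll L → WFAll ((a , c) ∷ L)

mutual
  data _≈_ : ∀ {n} → Contract n → Contract n → Set where
    ≈-refl  : ∀ {n} {c : Contract n} → c ≈ c
    ≈-sym   : ∀ {n} {c d : Contract n} → c ≈ d → d ≈ c
    ≈-trans : ∀ {n} {c d e : Contract n} → c ≈ d → d ≈ e → c ≈ e
    ≈-unfold : ∀ {n} {b : Contract (suc n)} → rec b ≈ unfoldBody b
    ≈-rec   : ∀ {n} {b b' : Contract (suc n)} → b ≈ b' → rec b ≈ rec b'
    ≈-Σ     : ∀ {n p} {L L' : List (Name × Contract n)} → L ≈L L' → Σ⟨ p ⟩ L ≈ Σ⟨ p ⟩ L'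
    ≈-⊕     : ∀ {n} {L L' : List (Name × Contract n)} → L ≈L L' → ⊕ L ≈ ⊕ L'
    ≈-Σperm : ∀ {n p} {L L' : List (Name × Contract n)} → L ↭ L' → Σ⟨ p ⟩ L ≈ Σ⟨ p ⟩ L'
    ≈-⊕perm : ∀ {n} {L L' : List (Name × Contract n)} → L ↭ L' → ⊕ L ≈ ⊕ L'
    ≈-unary : ∀ {n a} {c : Contract n} → Σ⟨ out ⟩ [ (a , c) ] ≈ ⊕ [ (a , c) ]

  data _≈L_ : ∀ {n} → List (Name × Contract n) → List (Name × Contract n) → Set where
    []  : ∀ {n} → _≈L_ {n} [] []
    _∷_ : ∀ {n a} {c d : Contract n} {L L'} → c ≈ d → L ≈L L' → ((a , c) ∷ L) ≈L ((a , d) ∷ L')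

-- Retractable contracts are the closed well-formed expressions.
RContract : Set
RContract = Contract 0

-- Contexts: finite sets of expressions ρ' ⊣ σ', represented as lists.
Ctx : Set
Ctx = List (RContract × RContract)

-- Derivability of Γ ▷ ρ ⊣ σ; every rule is applied modulo _≈_.
data _▷_⊣_ : Ctx → RContract → RContract → Set where
  Ax  : ∀ {Γ ρ σ} → ρ ≈ 𝟏 → Γ ▷ ρ ⊣ σ
  Hyp : ∀ {Γ ρ σ ρ' σ'} → (ρ' , σ') ∈ Γ → ρ ≈ ρ' → σ ≈ σ' → Γ ▷ ρ ⊣ σ
  R++ : ∀ {Γ ρ σ p L R a ρ₁ σ₁} →
        ρ ≈ Σ⟨ p ⟩ L → σ ≈ Σ⟨ dual p ⟩ R →
        (a , ρ₁) ∈ L → (a , σ₁) ∈ R →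
        ((ρ , σ) ∷ Γ) ▷ ρ₁ ⊣ σ₁ → Γ ▷ ρ ⊣ σ
  R⊕+ : ∀ {Γ ρ σ L R} →
        ρ ≈ ⊕ L → σ ≈ Σ⟨ inp ⟩ R →
        All (λ x → ∃[ σᵢ ] (((proj₁ x , σᵢ) ∈ R) × (((ρ , σ) ∷ Γ) ▷ proj₂ x ⊣ σᵢ))) L →
        Γ ▷ ρ ⊣ σ
  R+⊕ : ∀ {Γ ρ σ L R} →
        ρ ≈ Σ⟨ inp ⟩ R → σ ≈ ⊕ L →
        All (λ x → ∃[ σᵢ ] (((proj₁ x , σᵢ) ∈ R) × (((ρ , σ) ∷ Γ) ▷ proj₂ x ⊣ σᵢ))) L →
        Γ ▷ ρ ⊣ σ

{-# OPTIONS --safe #-}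

-- The equivalence _≈_ is a weak (inductive) recursive equivalence: two contracts are
-- equivalent iff unfolding recursions inside them leads to a common contract. Confluence holds
-- because unfolding all recursions once is monotone for, and cofinal in, the reduction. A
-- common reduct is found by comparing the two contracts from the root, where each rec is
-- either unfolded or opened with an unused variable taken from a finite pool; only finitely
-- many pairs arise, so the least fixed point of the comparison rules is computable. This
-- decides _≈_. In a derivation contracts may be replaced by their head normal forms, and
-- every rule but the axioms adds its conclusion to Γ, so among the finitely many reachable
-- pairs a proof search either stops or meets an assumption.
module Submission where

open import Defs
open import Data.Empty using (⊥; ⊥-elim)
open import Data.Fin using (Fin; zero; suc)
import Data.Fin.Properties as Fin
open import Data.List
  using (List; []; _∷_; _++_; length; map; filter; concatMap; cartesianProduct; allFin)
open import Data.List.Properties using (map-∘; map-id; length-filter; length-++)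
open import Data.List.Membership.Propositional using (_∈_; _∉_; find; lose)
open import Data.List.Membership.Propositional.Properties
  using (∈-map⁺; ∈-map⁻; ∈-∃++; ∈-++⁺ˡ; ∈-++⁺ʳ; ∈-++⁻; ∈-concatMap⁺; ∈-concatMap⁻; ∈-allFin;
         ∈-cartesianProduct⁺; ∈-cartesianProduct⁻)
open import Data.List.Membership.Setoid.Properties using (index-injective)
open import Data.List.Relation.Unary.All as All using (All; []; _∷_)
import Data.List.Relation.Unary.AllPairs as AllPairs
open import Data.List.Relation.Unary.Any as Any using (here; there)
open import Data.List.Relation.Unary.Unique.Propositional using (Unique)
open import Data.List.Relation.Binary.Permutation.Propositional
  using (_↭_; ↭-refl; ↭-sym; ↭-trans; prep; ↭⇒↭ₛ)
open import Data.List.Relation.Binary.Permutation.Propositional.Properties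
  using (∈-resp-↭; ↭-length; shift; map⁺)
open import Data.List.Relation.Binary.Permutation.Setoid.Properties using (Unique-resp-↭)
open import Data.Nat using (ℕ; zero; suc; _+_; _⊔_; _≤_; _<_; z≤n; s≤s)
import Data.Nat.Properties as ℕ
open import Data.Product using (_×_; _,_; proj₁; proj₂; ∃-syntax; map₂; swap; uncurry)
open import Data.Product.Properties using (≡-dec)
open import Data.Sum using (_⊎_; inj₁; inj₂)
open import Data.Unit using (tt)
open import Function using (_∘_)
open import Relation.Binary using (DecidableEquality)
open import Relation.Binary.Construct.Closure.Reflexive using (ReflClosure; refl; [_])
open import Relation.Binary.PropositionalEquality
  using (_≡_; _≢_; _≗_; refl; sym; trans; cong; cong₂; subst; subst₂; setoid; module ≡-Reasoning)
open import Relation.Nullary using (Dec; yes; no; ¬_; ¬?)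
open import Relation.Nullary.Decidable using (map′; _×-dec_; _⊎-dec_)
open import Relation.Unary using (Decidable)

private
  variable
    A B : Set
    n m l N : ℕ


-- The inductive `_≈_` is finer than equality of infinite unfoldings: rec x.a.x and rec x.a.a.x have
-- the same infinite unfolding, but no finite unfolding in common. The usual bisimulation test,
-- where meeting a pair again counts as success, would therefore be unsound; here only a finite
-- derivation counts. Choices are compared by name, which makes permutations invisible but also
-- identifies lists that differ only in repetitions. So `_≈_` implies joinability for all contracts,
-- while the converse is proved for well-formed ones. Working with well-formed contracts throughout
-- is no way out: a chain of equivalences between two of them may leave WF, since a variable is
-- equivalent to a recursion whose body is just that variable. Joinability bridges such chains, and
-- WF is required at their ends only.

Choice : ℕ → Set
Choice n = List (Name × Contract n)

-- Substitution

infixr 5 _◂_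
_◂_ : Contract m → (Fin n → Contract m) → Fin (suc n) → Contract m
(t ◂ s) zero = t
(t ◂ s) (suc i) = s i

inst : Contract n → Contract (suc n) → Contract n
inst t b = sub (t ◂ var) b

liftS-cong : {s t : Fin n → Contract m} → s ≗ t → liftS s ≗ liftS t
liftS-cong eq zero = refl
liftS-cong eq (suc i) = cong (ren suc) (eq i)

mutual
  sub-cong : {s t : Fin n → Contract m} → s ≗ t → sub s ≗ sub t
  sub-cong eq 𝟏 = refl
  sub-cong eq (Σ⟨ p ⟩ L) = cong Σ⟨ p ⟩ (subL-cong eq L)
  sub-cong eq (⊕ L) = cong ⊕ (subL-cong eq L)
  sub-cong eq (var i) = eq i
  sub-cong eq (rec b) = cong rec (sub-cong (liftS-cong eq) b)

  subL-cong : {s t : Fin n → Contract m} → s ≗ t → subL s ≗ subL t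
  subL-cong eq [] = refl
  subL-cong eq ((a , c) ∷ L) = cong₂ (λ d → (a , d) ∷_) (sub-cong eq c) (subL-cong eq L)

mutual
  ren≗sub : (f : Fin n → Fin m) → ren f ≗ sub (var ∘ f)
  ren≗sub f 𝟏 = refl
  ren≗sub f (Σ⟨ p ⟩ L) = cong Σ⟨ p ⟩ (renL≗subL f L)
  ren≗sub f (⊕ L) = cong ⊕ (renL≗subL f L)
  ren≗sub f (var i) = refl
  ren≗sub f (rec b) = cong rec
    (trans (ren≗sub (liftR f) b) (sub-cong (λ { zero → refl ; (suc i) → refl }) b))

  renL≗subL : (f : Fin n → Fin m) → renL f ≗ subL (var ∘ f)
  renL≗subL f [] = refl
  renL≗subL f ((a , c) ∷ L) = cong₂ (λ d → (a , d) ∷_) (ren≗sub f c) (renL≗subL f L)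

mutual
  sub-ren : (s : Fin m → Contract l) (f : Fin n → Fin m) → sub s ∘ ren f ≗ sub (s ∘ f)
  sub-ren s f 𝟏 = refl
  sub-ren s f (Σ⟨ p ⟩ L) = cong Σ⟨ p ⟩ (subL-renL s f L)
  sub-ren s f (⊕ L) = cong ⊕ (subL-renL s f L)
  sub-ren s f (var i) = refl
  sub-ren s f (rec b) = cong rec
    (trans (sub-ren (liftS s) (liftR f) b) (sub-cong (λ { zero → refl ; (suc i) → refl }) b))

  subL-renL : (s : Fin m → Contract l) (f : Fin n → Fin m) → subL s ∘ renL f ≗ subL (s ∘ f)
  subL-renL s f [] = refl
  subL-renL s f ((a , c) ∷ L) = cong₂ (λ d → (a , d) ∷_) (sub-ren s f c) (subL-renL s f L)

ren-ren : (f : Fin m → Fin l) (g : Fin n → Fin m) → ren f ∘ ren g ≗ ren (f ∘ g)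
ren-ren f g c = trans (ren≗sub f (ren g c)) (trans (sub-ren (var ∘ f) g c) (sym (ren≗sub (f ∘ g) c)))

mutual
  ren-sub : (f : Fin m → Fin l) (s : Fin n → Contract m) → ren f ∘ sub s ≗ sub (ren f ∘ s)
  ren-sub f s 𝟏 = refl
  ren-sub f s (Σ⟨ p ⟩ L) = cong Σ⟨ p ⟩ (renL-subL f s L)
  ren-sub f s (⊕ L) = cong ⊕ (renL-subL f s L)
  ren-sub f s (var i) = refl
  ren-sub f s (rec b) = cong rec (trans (ren-sub (liftR f) (liftS s) b) (sub-cong lift-comm b))
    where
    lift-comm : ren (liftR f) ∘ liftS s ≗ liftS (ren f ∘ s)
    lift-comm zero = refl
    lift-comm (suc i) = trans (ren-ren (liftR f) suc (s i)) (sym (ren-ren suc f (s i)))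

  renL-subL : (f : Fin m → Fin l) (s : Fin n → Contract m) → renL f ∘ subL s ≗ subL (ren f ∘ s)
  renL-subL f s [] = refl
  renL-subL f s ((a , c) ∷ L) = cong₂ (λ d → (a , d) ∷_) (ren-sub f s c) (renL-subL f s L)

mutual
  sub-sub : (t : Fin m → Contract l) (s : Fin n → Contract m) → sub t ∘ sub s ≗ sub (sub t ∘ s)
  sub-sub t s 𝟏 = refl
  sub-sub t s (Σ⟨ p ⟩ L) = cong Σ⟨ p ⟩ (subL-subL t s L)
  sub-sub t s (⊕ L) = cong ⊕ (subL-subL t s L)
  sub-sub t s (var i) = refl
  sub-sub t s (rec b) = cong rec (trans (sub-sub (liftS t) (liftS s) b) (sub-cong lift-comm b))
    where
    lift-comm : sub (liftS t) ∘ liftS s ≗ liftS (sub t ∘ s)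
    lift-comm zero = refl
    lift-comm (suc i) = trans (sub-ren (liftS t) suc (s i)) (sym (ren-sub suc t (s i)))

  subL-subL : (t : Fin m → Contract l) (s : Fin n → Contract m) → subL t ∘ subL s ≗ subL (sub t ∘ s)
  subL-subL t s [] = refl
  subL-subL t s ((a , c) ∷ L) = cong₂ (λ d → (a , d) ∷_) (sub-sub t s c) (subL-subL t s L)

mutual
  sub-var : {s : Fin n → Contract n} → s ≗ var → ∀ c → sub s c ≡ c
  sub-var eq 𝟏 = refl
  sub-var eq (Σ⟨ p ⟩ L) = cong Σ⟨ p ⟩ (subL-var eq L)
  sub-var eq (⊕ L) = cong ⊕ (subL-var eq L)
  sub-var eq (var i) = eq i
  sub-var eq (rec b) = cong rec
    (sub-var (λ { zero → refl ; (suc i) → cong (ren suc) (eq i) }) b)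

  subL-var : {s : Fin n → Contract n} → s ≗ var → ∀ L → subL s L ≡ L
  subL-var eq [] = refl
  subL-var eq ((a , c) ∷ L) = cong₂ (λ d → (a , d) ∷_) (sub-var eq c) (subL-var eq L)

-- `states` extends an environment, as on the left; `_⟶_` instantiates a body, as on the right. The
-- equation translates between the two.
sub-◂ : (t : Contract m) (θ : Fin n → Contract m) → ∀ b → sub (t ◂ θ) b ≡ inst t (sub (liftS θ) b)
sub-◂ t θ b = sym (trans (sub-sub (t ◂ var) (liftS θ) b) (sub-cong lemma b))
  where
  lemma : sub (t ◂ var) ∘ liftS θ ≗ t ◂ θ
  lemma zero = refl
  lemma (suc i) = trans (sub-ren (t ◂ var) suc (θ i)) (sub-var (λ _ → refl) (θ i))

sub-inst : (s : Fin n → Contract m) (t : Contract n) → ∀ b →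
  sub s (inst t b) ≡ inst (sub s t) (sub (liftS s) b)
sub-inst s t b = trans (sub-sub s (t ◂ var) b)
  (trans (sub-cong (λ { zero → refl ; (suc i) → refl }) b) (sub-◂ (sub s t) s b))

sub-unfold : (s : Fin n → Contract m) → ∀ b →
  sub s (inst (rec b) b) ≡ inst (sub s (rec b)) (sub (liftS s) b)
sub-unfold s b = sub-inst s (rec b) b

ren-inst : (f : Fin n → Fin m) (t : Contract n) → ∀ b →
  ren f (inst t b) ≡ inst (ren f t) (ren (liftR f) b)
ren-inst f t b = trans (ren-sub f (t ◂ var) b)
  (sym (trans (sub-ren (ren f t ◂ var) (liftR f) b)
    (sub-cong (λ { zero → refl ; (suc i) → refl }) b)))

-- The substitution inside `unfoldBody` is a local function, equal to `rec b ◂ var` only pointwise.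
unfoldBody≡inst : (b : Contract (suc n)) → unfoldBody b ≡ inst (rec b) b
unfoldBody≡inst b = sub-cong (λ { zero → refl ; (suc i) → refl }) b

-- Choice nodes

data Kind : Set where
  input output internal : Kind

-- A unary retractable output counts as internal, in agreement with ≈-unary.
kd : Pol → List A → Kind
kd inp _ = input
kd out (_ ∷ []) = internal
kd out _ = output

data Node {n : ℕ} : Contract n → Kind → Choice n → Set where
  Σ-node : ∀ {p L k} → kd p L ≡ k → Node (Σ⟨ p ⟩ L) k L
  ⊕-node : ∀ {L} → Node (⊕ L) internal L

Node-unique : ∀ {c : Contract n} {k k′ L L′} → Node c k L → Node c k′ L′ → k ≡ k′ × L ≡ L′
Node-unique (Σ-node refl) (Σ-node refl) = refl , refl
Node-unique ⊕-node ⊕-node = refl , refl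

kd-length : ∀ p (L : List A) (L′ : List B) → length L ≡ length L′ → kd p L ≡ kd p L′
kd-length inp L L′ eq = refl
kd-length out [] [] eq = refl
kd-length out (_ ∷ []) (_ ∷ []) eq = refl
kd-length out (_ ∷ _ ∷ _) (_ ∷ _ ∷ _) eq = refl

kd-map : ∀ p (f : A → B) (L : List A) → kd p (map f L) ≡ kd p L
kd-map inp f L = refl
kd-map out f [] = refl
kd-map out f (_ ∷ []) = refl
kd-map out f (_ ∷ _ ∷ _) = refl

mp : (A → B) → List (Name × A) → List (Name × B)
mp f = map (map₂ f)

∈-mp⁺ : (f : A → B) → ∀ {a c L} → (a , c) ∈ L → (a , f c) ∈ mp f L
∈-mp⁺ f = ∈-map⁺ (map₂ f)

∈-mp⁻ : (f : A → B) → ∀ {a d L} → (a , d) ∈ mp f L → ∃[ c ] ((a , c) ∈ L × d ≡ f c)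
∈-mp⁻ f d∈ with ∈-map⁻ (map₂ f) d∈
... | (_ , c) , c∈ , refl = c , c∈ , refl

renL≡mp : (f : Fin n → Fin m) → renL f ≗ mp (ren f)
renL≡mp f [] = refl
renL≡mp f (x ∷ L) = cong (_ ∷_) (renL≡mp f L)

subL≡mp : (s : Fin n → Contract m) → subL s ≗ mp (sub s)
subL≡mp s [] = refl
subL≡mp s (x ∷ L) = cong (_ ∷_) (subL≡mp s L)

Node-ren : ∀ (f : Fin n → Fin m) {c k L} → Node c k L → Node (ren f c) k (mp (ren f) L)
Node-ren f (Σ-node {p} {L} eq) rewrite renL≡mp f L = Σ-node (trans (kd-map p _ L) eq)
Node-ren f (⊕-node {L}) rewrite renL≡mp f L = ⊕-node

Node-sub : ∀ (s : Fin n → Contract m) {c k L} → Node c k L → Node (sub s c) k (mp (sub s) L)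
Node-sub s (Σ-node {p} {L} eq) rewrite subL≡mp s L = Σ-node (trans (kd-map p _ L) eq)
Node-sub s (⊕-node {L}) rewrite subL≡mp s L = ⊕-node

module _ (P : ∀ {n} → Contract n → Set)
  (P𝟏 : ∀ {n} → P {n} 𝟏)
  (Pnode : ∀ {n} {c : Contract n} {k L} → Node c k L → (∀ {a d} → (a , d) ∈ L → P d) → P c)
  (Pvar : ∀ {n} (i : Fin n) → P (var i))
  (Prec : ∀ {n} {b : Contract (suc n)} → P b → P (rec b)) where
  mutual
    Contract-ind : (c : Contract n) → P c
    Contract-ind 𝟏 = P𝟏
    Contract-ind (Σ⟨ p ⟩ L) = Pnode (Σ-node refl) (Contract-indL L)
    Contract-ind (⊕ L) = Pnode ⊕-node (Contract-indL L)
    Contract-ind (var i) = Pvar i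
    Contract-ind (rec b) = Prec (Contract-ind b)

    Contract-indL : (L : Choice n) → ∀ {a d} → (a , d) ∈ L → P d
    Contract-indL ((_ , c) ∷ L) (here refl) = Contract-ind c
    Contract-indL (_ ∷ L) (there d∈) = Contract-indL L d∈

-- Matching of the summands of two choices by their names; on choices with distinct names
-- this is a bijection, but lists with repetitions are not told apart.
Match : (A → B → Set) → List (Name × A) → List (Name × B) → Set
Match X L L′ =
  (∀ {a c} → (a , c) ∈ L → ∃[ d ] ((a , d) ∈ L′ × X c d)) ×
  (∀ {a d} → (a , d) ∈ L′ → ∃[ c ] ((a , c) ∈ L × X c d))

Match-mp : {A′ B′ : Set} {Y : A′ → B′ → Set} (f : A → A′) (g : B → B′) → ∀ {L L′} →
  Match (λ c d → Y (f c) (g d)) L L′ → Match Y (mp f L) (mp g L′)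
Match-mp {Y = Y} f g (fw , bw) =
  (λ x∈ → let c , c∈ , eq = ∈-mp⁻ f x∈ ; d , d∈ , y = fw c∈
          in g d , ∈-mp⁺ g d∈ , subst (λ x → Y x (g d)) (sym eq) y) ,
  (λ x∈ → let d , d∈ , eq = ∈-mp⁻ g x∈ ; c , c∈ , y = bw d∈
          in f c , ∈-mp⁺ f c∈ , subst (Y (f c)) (sym eq) y)

-- Reduction to a common unfolding

infix 4 _↠_

-- Many-step unfolding in standard order, like the standard reductions of the λ-calculus: unfoldings
-- at the root come before those below it. Transitivity is thus a theorem, and a derivation can be
-- read from the root down.
data _↠_ : ∀ {n} → Contract n → Contract n → Set where
  ↠-𝟏 : 𝟏 {n} ↠ 𝟏
  ↠-var : {i : Fin n} → var i ↠ var i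
  ↠-node : ∀ {c d : Contract n} {k L L′} → Node c k L → Node d k L′ → Match _↠_ L L′ → c ↠ d
  ↠-rec : {b b′ : Contract (suc n)} → b ↠ b′ → rec b ↠ rec b′
  ↠-unfold : {b : Contract (suc n)} {d : Contract n} → inst (rec b) b ↠ d → rec b ↠ d

↠-refl : (c : Contract n) → c ↠ c
↠-refl = Contract-ind (λ c → c ↠ c) ↠-𝟏
  (λ nd ih → ↠-node nd nd ((λ c∈ → _ , c∈ , ih c∈) , (λ c∈ → _ , c∈ , ih c∈)))
  (λ i → ↠-var) ↠-rec

≡⇒↠ : {c d : Contract n} → c ≡ d → c ↠ d
≡⇒↠ refl = ↠-refl _

↠-respˡ : {c c′ d : Contract n} → c ≡ c′ → c ↠ d → c′ ↠ d
↠-respˡ refl r = r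

↠-respʳ : {c d d′ : Contract n} → d ≡ d′ → c ↠ d → c ↠ d′
↠-respʳ refl r = r

↠-ren : (f : Fin n → Fin m) {c d : Contract n} → c ↠ d → ren f c ↠ ren f d
↠-ren f ↠-𝟏 = ↠-𝟏
↠-ren f ↠-var = ↠-var
↠-ren f (↠-node nc nd (fw , bw)) = ↠-node (Node-ren f nc) (Node-ren f nd) (Match-mp (ren f) (ren f)
  ( (λ c∈ → let d , d∈ , r = fw c∈ in d , d∈ , ↠-ren f r)
  , (λ d∈ → let c , c∈ , r = bw d∈ in c , c∈ , ↠-ren f r)))
↠-ren f (↠-rec r) = ↠-rec (↠-ren (liftR f) r)
↠-ren f (↠-unfold {b = b} r) = ↠-unfold (↠-respˡ (ren-inst f (rec b) b) (↠-ren f r))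

↠-liftS : {s t : Fin n → Contract m} → (∀ i → s i ↠ t i) → ∀ i → liftS s i ↠ liftS t i
↠-liftS st zero = ↠-var
↠-liftS st (suc i) = ↠-ren suc (st i)

↠-sub : {s t : Fin n → Contract m} → (∀ i → s i ↠ t i) → {c d : Contract n} → c ↠ d → sub s c ↠ sub t d
↠-sub st ↠-𝟏 = ↠-𝟏
↠-sub st (↠-var {i = i}) = st i
↠-sub {s = s} {t} st (↠-node nc nd (fw , bw)) = ↠-node (Node-sub s nc) (Node-sub t nd) (Match-mp (sub s) (sub t)
  ( (λ c∈ → let d , d∈ , r = fw c∈ in d , d∈ , ↠-sub st r)
  , (λ d∈ → let c , c∈ , r = bw d∈ in c , c∈ , ↠-sub st r)))
↠-sub st (↠-rec r) = ↠-rec (↠-sub (↠-liftS st) r)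
↠-sub {s = s} st (↠-unfold {b = b} r) =
  ↠-unfold (↠-respˡ (sub-unfold s b) (↠-sub st r))

↠-inst : {t t′ : Contract n} {b b′ : Contract (suc n)} → t ↠ t′ → b ↠ b′ → inst t b ↠ inst t′ b′
↠-inst rt = ↠-sub λ { zero → rt ; (suc i) → ↠-var }

↠-trans : {c d e : Contract n} → c ↠ d → d ↠ e → c ↠ e
↠-trans ↠-𝟏 s = s
↠-trans ↠-var s = s
↠-trans (↠-unfold r) s = ↠-unfold (↠-trans r s)
↠-trans (↠-rec r) (↠-rec s) = ↠-rec (↠-trans r s)
-- The reduction of the body is replayed in every copy made by the unfolding. The first derivation
-- grows, but the second gets smaller.
↠-trans (↠-rec r) (↠-unfold s) = ↠-unfold (↠-trans (↠-inst (↠-rec r) r) s)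
↠-trans (↠-node nc nd (f , g)) (↠-node nd′ ne (f′ , g′)) with Node-unique nd nd′
... | refl , refl = ↠-node nc ne
  ( (λ c∈ → let d , d∈ , x = f c∈ ; e , e∈ , y = f′ d∈ in e , e∈ , ↠-trans x y)
  , (λ e∈ → let d , d∈ , y = g′ e∈ ; c , c∈ , x = g d∈ in c , c∈ , ↠-trans x y))

-- Confluence by complete developments

mutual
  -- Takahashi's complete development. As `_↠_` may unfold one recursion many times, `dev c` alone
  -- does not bound all reducts of `c`; the iterates `dev^ k c` do.
  dev : Contract n → Contract n
  dev 𝟏 = 𝟏
  dev (Σ⟨ p ⟩ L) = Σ⟨ p ⟩ (devL L)
  dev (⊕ L) = ⊕ (devL L)
  dev (var i) = var i
  dev (rec b) = inst (rec (dev b)) (dev b)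

  devL : Choice n → Choice n
  devL [] = []
  devL ((a , c) ∷ L) = (a , dev c) ∷ devL L

devL≡mp : (L : Choice n) → devL L ≡ mp dev L
devL≡mp [] = refl
devL≡mp (x ∷ L) = cong (_ ∷_) (devL≡mp L)

Node-dev : {c : Contract n} → ∀ {k L} → Node c k L → Node (dev c) k (mp dev L)
Node-dev (Σ-node {p} {L} eq) rewrite devL≡mp L = Σ-node (trans (kd-map p _ L) eq)
Node-dev (⊕-node {L}) rewrite devL≡mp L = ⊕-node

mutual
  dev-ren : (f : Fin n → Fin m) → dev ∘ ren f ≗ ren f ∘ dev
  dev-ren f 𝟏 = refl
  dev-ren f (Σ⟨ p ⟩ L) = cong Σ⟨ p ⟩ (devL-renL f L)
  dev-ren f (⊕ L) = cong ⊕ (devL-renL f L)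
  dev-ren f (var i) = refl
  dev-ren f (rec b) = trans (cong (λ b′ → inst (rec b′) b′) (dev-ren (liftR f) b))
    (sym (ren-inst f (rec (dev b)) (dev b)))

  devL-renL : (f : Fin n → Fin m) → devL ∘ renL f ≗ renL f ∘ devL
  devL-renL f [] = refl
  devL-renL f ((a , c) ∷ L) = cong₂ (λ d → (a , d) ∷_) (dev-ren f c) (devL-renL f L)

mutual
  dev-sub : (s : Fin n → Contract m) → dev ∘ sub s ≗ sub (dev ∘ s) ∘ dev
  dev-sub s 𝟏 = refl
  dev-sub s (Σ⟨ p ⟩ L) = cong Σ⟨ p ⟩ (devL-subL s L)
  dev-sub s (⊕ L) = cong ⊕ (devL-subL s L)
  dev-sub s (var i) = refl
  dev-sub s (rec b) = trans (cong (λ b′ → inst (rec b′) b′) eq)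
    (sym (sub-unfold (dev ∘ s) (dev b)))
    where
    eq : dev (sub (liftS s) b) ≡ sub (liftS (dev ∘ s)) (dev b)
    eq = trans (dev-sub (liftS s) b)
      (sub-cong (λ { zero → refl ; (suc i) → dev-ren suc (s i) }) (dev b))

  devL-subL : (s : Fin n → Contract m) → devL ∘ subL s ≗ subL (dev ∘ s) ∘ devL
  devL-subL s [] = refl
  devL-subL s ((a , c) ∷ L) = cong₂ (λ d → (a , d) ∷_) (dev-sub s c) (devL-subL s L)

dev-inst : (t : Contract n) (b : Contract (suc n)) → dev (inst t b) ≡ inst (dev t) (dev b)
dev-inst t b = trans (dev-sub (t ◂ var) b)
  (sub-cong (λ { zero → refl ; (suc i) → refl }) (dev b))

Match-mpʳ : {Y : A → B → Set} (f : A → B) → ∀ {L} →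
  (∀ {a c} → (a , c) ∈ L → Y c (f c)) → Match Y L (mp f L)
Match-mpʳ {Y = Y} f y =
  (λ c∈ → _ , ∈-mp⁺ f c∈ , y c∈) ,
  (λ d∈ → let c , c∈ , eq = ∈-mp⁻ f d∈ in c , c∈ , subst (Y c) (sym eq) (y c∈))

↠-dev : (c : Contract n) → c ↠ dev c
↠-dev = Contract-ind (λ c → c ↠ dev c) ↠-𝟏
  (λ nd ih → ↠-node nd (Node-dev nd) (Match-mpʳ dev ih))
  (λ i → ↠-var) (λ r → ↠-unfold (↠-inst (↠-rec r) r))

dev-mono : {c d : Contract n} → c ↠ d → dev c ↠ dev d
dev-mono ↠-𝟏 = ↠-𝟏
dev-mono ↠-var = ↠-var
dev-mono (↠-node nc nd (fw , bw)) = ↠-node (Node-dev nc) (Node-dev nd) (Match-mp dev dev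
  ( (λ c∈ → let d , d∈ , r = fw c∈ in d , d∈ , dev-mono r)
  , (λ d∈ → let c , c∈ , r = bw d∈ in c , c∈ , dev-mono r)))
dev-mono (↠-rec r) = ↠-inst (↠-rec (dev-mono r)) (dev-mono r)
-- `dev (rec b)` still has `rec (dev b)` in place of the bound variable; unfolding these copies once
-- more gives `dev (inst (rec b) b)`.
dev-mono (↠-unfold {b = b} r) = ↠-trans
  (↠-inst (↠-unfold (↠-refl _)) (↠-refl (dev b)))
  (↠-respˡ (dev-inst (rec b) b) (dev-mono r))

dev^ : ℕ → Contract n → Contract n
dev^ zero c = c
dev^ (suc k) c = dev (dev^ k c)

dev^-comm : ∀ k (c : Contract n) → dev^ k (dev c) ≡ dev (dev^ k c)
dev^-comm zero c = refl
dev^-comm (suc k) c = cong dev (dev^-comm k c)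

dev^-mono : ∀ k {c d : Contract n} → c ↠ d → dev^ k c ↠ dev^ k d
dev^-mono zero r = r
dev^-mono (suc k) r = dev-mono (dev^-mono k r)

↠-dev^ : ∀ k (c : Contract n) → c ↠ dev^ k c
↠-dev^ zero c = ↠-refl c
↠-dev^ (suc k) c = ↠-trans (↠-dev^ k c) (↠-dev _)

dev^-≤ : ∀ {j k} (c : Contract n) → j ≤ k → dev^ j c ↠ dev^ k c
dev^-≤ {k = k} c z≤n = ↠-dev^ k c
dev^-≤ c (s≤s j≤k) = dev-mono (dev^-≤ c j≤k)

Node-dev^ : ∀ j {c : Contract n} {k L} → Node c k L → Node (dev^ j c) k (mp (dev^ j) L)
Node-dev^ zero {L = L} nc = subst (Node _ _) (sym (map-id L)) nc
Node-dev^ (suc j) {L = L} nc = subst (Node _ _) (sym (map-∘ L)) (Node-dev (Node-dev^ j nc))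

-- `rec (dev c)` unfolds in one step to `dev (rec c)`, by definition of `dev`.
rec-dev^ : ∀ k (b : Contract (suc n)) → rec (dev^ k b) ↠ dev^ k (rec b)
rec-dev^ zero b = ↠-refl (rec b)
rec-dev^ (suc k) b = ↠-trans (↠-unfold (↠-refl _)) (dev-mono (rec-dev^ k b))

uniform-bound : {P : ℕ → A → Set} → (∀ {j k x} → j ≤ k → P j x → P k x) → (L : List A) →
  (∀ {x} → x ∈ L → ∃[ k ] P k x) → ∃[ k ] (∀ {x} → x ∈ L → P k x)
uniform-bound mono [] h = 0 , λ ()
uniform-bound mono (x ∷ L) h =
  let j , pj = h (here refl) ; k , pk = uniform-bound mono L (h ∘ there)
  in j ⊔ k , λ { (here refl) → mono (ℕ.m≤m⊔n j k) pj ; (there x∈) → mono (ℕ.m≤n⊔m j k) (pk x∈) }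

dev^-cofinal : {c d : Contract n} → c ↠ d → ∃[ k ] (d ↠ dev^ k c)
dev^-cofinal ↠-𝟏 = 0 , ↠-𝟏
dev^-cofinal ↠-var = 0 , ↠-var
dev^-cofinal (↠-node {L = L} {L′} nc nd (fw , bw)) =
  let j , fw′ = uniform-bound {P = λ k x → ∃[ d ] ((proj₁ x , d) ∈ L′ × d ↠ dev^ k (proj₂ x))}
        (λ j≤k → λ { (d , d∈ , r) → d , d∈ , ↠-trans r (dev^-≤ _ j≤k) }) L
        (λ c∈ → let d , d∈ , r = fw c∈ ; k , s = dev^-cofinal r in k , d , d∈ , s)
      k , bw′ = uniform-bound {P = λ k x → ∃[ c ] ((proj₁ x , c) ∈ L × proj₂ x ↠ dev^ k c)}
        (λ j≤k → λ { (c , c∈ , r) → c , c∈ , ↠-trans r (dev^-≤ _ j≤k) }) L′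
        (λ d∈ → let c , c∈ , r = bw d∈ ; k , s = dev^-cofinal r in k , c , c∈ , s)
  in j ⊔ k , ↠-node nd (Node-dev^ (j ⊔ k) nc)
    ( (λ d∈ → let c , c∈ , r = bw′ d∈
              in dev^ (j ⊔ k) c , ∈-mp⁺ _ c∈ , ↠-trans r (dev^-≤ c (ℕ.m≤n⊔m j k)))
    , (λ e∈ → let c , c∈ , eq = ∈-mp⁻ (dev^ (j ⊔ k)) e∈
                  d , d∈ , r = fw′ c∈
              in d , d∈ , ↠-trans r (↠-respʳ (sym eq) (dev^-≤ c (ℕ.m≤m⊔n j k)))))
dev^-cofinal (↠-rec {b = b} r) =
  let k , s = dev^-cofinal r in k , ↠-trans (↠-rec s) (rec-dev^ k b)
dev^-cofinal (↠-unfold {b = b} r) =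
  let k , s = dev^-cofinal r
  -- The extra development pays for the unfolding at the root: `inst (rec b) b ↠ dev (rec b)`.
  in suc k , ↠-trans s (↠-respʳ (dev^-comm k (rec b))
       (dev^-mono k (↠-inst (↠-rec (↠-dev b)) (↠-dev b))))

-- Joinability contains the equivalence

infix 4 _⋈_

_⋈_ : Contract n → Contract n → Set
c ⋈ d = ∃[ e ] (c ↠ e × d ↠ e)

↠-confluent : {c d e : Contract n} → c ↠ d → c ↠ e → d ⋈ e
↠-confluent {c = c} r s =
  let j , r′ = dev^-cofinal r ; k , s′ = dev^-cofinal s
  in dev^ (j ⊔ k) c , ↠-trans r′ (dev^-≤ c (ℕ.m≤m⊔n j k)) , ↠-trans s′ (dev^-≤ c (ℕ.m≤n⊔m j k))

↠⇒⋈ : {c d : Contract n} → c ↠ d → c ⋈ d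
↠⇒⋈ r = _ , r , ↠-refl _

⋈-refl : {c : Contract n} → c ⋈ c
⋈-refl = ↠⇒⋈ (↠-refl _)

⋈-sym : {c d : Contract n} → c ⋈ d → d ⋈ c
⋈-sym = map₂ swap

⋈-trans : {c d e : Contract n} → c ⋈ d → d ⋈ e → c ⋈ e
⋈-trans (_ , r , s) (_ , r′ , s′) =
  let f , t , t′ = ↠-confluent s r′ in f , ↠-trans r t , ↠-trans s′ t′

Match-∷ : ∀ {X : A → B → Set} {a c d L L′} → X c d → Match X L L′ →
  Match X ((a , c) ∷ L) ((a , d) ∷ L′)
Match-∷ x (fw , bw) =
  (λ { (here refl) → _ , here refl , x
     ; (there c∈) → let d , d∈ , y = fw c∈ in d , there d∈ , y }) ,
  (λ { (here refl) → _ , here refl , x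
     ; (there d∈) → let c , c∈ , y = bw d∈ in c , there c∈ , y })

↭⇒Match : {L L′ : Choice n} → L ↭ L′ → Match _↠_ L L′
↭⇒Match π =
  (λ c∈ → _ , ∈-resp-↭ π c∈ , ↠-refl _) ,
  (λ d∈ → _ , ∈-resp-↭ (↭-sym π) d∈ , ↠-refl _)

mutual
  ≈⇒⋈ : {c d : Contract n} → c ≈ d → c ⋈ d
  ≈⇒⋈ ≈-refl = ⋈-refl
  ≈⇒⋈ (≈-sym e) = ⋈-sym (≈⇒⋈ e)
  ≈⇒⋈ (≈-trans e f) = ⋈-trans (≈⇒⋈ e) (≈⇒⋈ f)
  ≈⇒⋈ (≈-unfold {b = b}) = ↠⇒⋈ (↠-unfold (≡⇒↠ (sym (unfoldBody≡inst b))))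
  ≈⇒⋈ (≈-rec e) = let f , r , s = ≈⇒⋈ e in rec f , ↠-rec r , ↠-rec s
  ≈⇒⋈ (≈-Σ {p = p} {L} {L′} e) =
    let K , l , l′ , r , s = ≈L⇒⋈ e
    in Σ⟨ p ⟩ K , ↠-node (Σ-node (kd-length p L K l)) (Σ-node refl) r
                , ↠-node (Σ-node (kd-length p L′ K l′)) (Σ-node refl) s
  ≈⇒⋈ (≈-⊕ e) =
    let K , l , l′ , r , s = ≈L⇒⋈ e
    in ⊕ K , ↠-node ⊕-node ⊕-node r , ↠-node ⊕-node ⊕-node s
  ≈⇒⋈ (≈-Σperm {p = p} {L} {L′} π) = ↠⇒⋈
    (↠-node (Σ-node (kd-length p L L′ (↭-length π))) (Σ-node refl) (↭⇒Match π))
  ≈⇒⋈ (≈-⊕perm π) = ↠⇒⋈ (↠-node ⊕-node ⊕-node (↭⇒Match π))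
  ≈⇒⋈ ≈-unary = ↠⇒⋈ (↠-node (Σ-node refl) ⊕-node (↭⇒Match ↭-refl))

  -- Lengths are recorded because `Match` forgets multiplicity, while the kind of an output sum
  -- depends on whether it is unary.
  ≈L⇒⋈ : {L L′ : Choice n} → L ≈L L′ →
    ∃[ K ] (length L ≡ length K × length L′ ≡ length K × Match _↠_ L K × Match _↠_ L′ K)
  ≈L⇒⋈ [] = [] , refl , refl , ((λ ()) , (λ ())) , ((λ ()) , (λ ()))
  ≈L⇒⋈ (_∷_ {a = a} e es) =
    let f , r , s = ≈⇒⋈ e ; K , l , l′ , rs , ss = ≈L⇒⋈ es
    in (a , f) ∷ K , cong suc l , cong suc l′ , Match-∷ r rs , Match-∷ s ss

-- Well-formedness

labels-renL : (f : Fin n → Fin m) (L : Choice n) → map proj₁ (renL f L) ≡ map proj₁ L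
labels-renL f [] = refl
labels-renL f ((a , _) ∷ L) = cong (a ∷_) (labels-renL f L)

labels-subL : (s : Fin n → Contract m) (L : Choice n) → map proj₁ (subL s L) ≡ map proj₁ L
labels-subL s [] = refl
labels-subL s ((a , _) ∷ L) = cong (a ∷_) (labels-subL s L)

IsVar-ren : (f : Fin n → Fin m) (c : Contract n) → IsVar (ren f c) → IsVar c
IsVar-ren f (var i) _ = tt

IsVar-sub : (s : Fin n → Contract m) (c : Contract n) → IsVar (sub s c) → IsVar c
IsVar-sub s (var i) _ = tt

mutual
  WF-ren : (f : Fin n → Fin m) {c : Contract n} → WF c → WF (ren f c)
  WF-ren f wf-𝟏 = wf-𝟏
  WF-ren f (wf-Σ w) = wf-Σ (WFChoice-renL f w)
  WF-ren f (wf-⊕ w) = wf-⊕ (WFChoice-renL f w)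
  WF-ren f wf-var = wf-var
  WF-ren f (wf-rec {b = b} ¬v w) = wf-rec (¬v ∘ IsVar-ren (liftR f) b) (WF-ren (liftR f) w)

  WFChoice-renL : (f : Fin n → Fin m) {L : Choice n} → WFChoice L → WFChoice (renL f L)
  WFChoice-renL f {L} (wfChoice nonEmpty u w) =
    wfChoice nonEmpty (subst Unique (sym (labels-renL f L)) u) (WFAll-renL f w)

  WFAll-renL : (f : Fin n → Fin m) {L : Choice n} → WFAll L → WFAll (renL f L)
  WFAll-renL f [] = []
  WFAll-renL f (w ∷ ws) = WF-ren f w ∷ WFAll-renL f ws

WF-liftS : {s : Fin n → Contract m} → (∀ i → WF (s i)) → ∀ i → WF (liftS s i)
WF-liftS ws zero = wf-var
WF-liftS ws (suc i) = WF-ren suc (ws i)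

mutual
  WF-sub : {s : Fin n → Contract m} → (∀ i → WF (s i)) → {c : Contract n} → WF c → WF (sub s c)
  WF-sub ws wf-𝟏 = wf-𝟏
  WF-sub ws (wf-Σ w) = wf-Σ (WFChoice-subL ws w)
  WF-sub ws (wf-⊕ w) = wf-⊕ (WFChoice-subL ws w)
  WF-sub ws (wf-var {i = i}) = ws i
  WF-sub ws (wf-rec {b = b} ¬v w) = wf-rec (¬v ∘ IsVar-sub _ b) (WF-sub (WF-liftS ws) w)

  WFChoice-subL : {s : Fin n → Contract m} → (∀ i → WF (s i)) → {L : Choice n} →
    WFChoice L → WFChoice (subL s L)
  WFChoice-subL {s = s} ws {L} (wfChoice nonEmpty u w) =
    wfChoice nonEmpty (subst Unique (sym (labels-subL s L)) u) (WFAll-subL ws w)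

  WFAll-subL : {s : Fin n → Contract m} → (∀ i → WF (s i)) → {L : Choice n} → WFAll L → WFAll (subL s L)
  WFAll-subL ws [] = []
  WFAll-subL ws (w ∷ wsL) = WF-sub ws w ∷ WFAll-subL ws wsL

WF-inst : {t : Contract n} {b : Contract (suc n)} → WF t → WF b → WF (inst t b)
WF-inst wt = WF-sub λ { zero → wt ; (suc i) → wf-var }

WF-unfold : {b : Contract (suc n)} → WF (rec b) → WF (inst (rec b) b)
WF-unfold w@(wf-rec _ wb) = WF-inst w wb

WF-body : {b : Contract (suc n)} → WF (rec b) → WF b
WF-body (wf-rec _ w) = w

WF-node : ∀ {c : Contract n} {k L} → Node c k L → WF c → WFChoice L
WF-node (Σ-node _) (wf-Σ w) = w
WF-node ⊕-node (wf-⊕ w) = w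

WF-∈ : ∀ {L : Choice n} {a c} → WFChoice L → (a , c) ∈ L → WF c
WF-∈ (wfChoice _ _ w) = go w
  where
  go : ∀ {L a c} → WFAll L → (a , c) ∈ L → WF c
  go (w ∷ _) (here refl) = w
  go (_ ∷ ws) (there c∈) = go ws c∈

-- Matching choices with distinct names are equivalent

≡⇒≈ : {c d : Contract n} → c ≡ d → c ≈ d
≡⇒≈ refl = ≈-refl

⟪_⟫ : Kind → Choice n → Contract n
⟪ input ⟫ = Σ⟨ inp ⟩
⟪ output ⟫ = Σ⟨ out ⟩
⟪ internal ⟫ = ⊕

Node-≈ : ∀ {c : Contract n} {k L} → Node c k L → c ≈ ⟪ k ⟫ L
Node-≈ (Σ-node {inp} refl) = ≈-refl
Node-≈ (Σ-node {out} {[]} refl) = ≈-refl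
Node-≈ (Σ-node {out} {_ ∷ []} refl) = ≈-unary
Node-≈ (Σ-node {out} {_ ∷ _ ∷ _} refl) = ≈-refl
Node-≈ ⊕-node = ≈-refl

⟪⟫-congL : ∀ k {L L′ : Choice n} → L ≈L L′ → ⟪ k ⟫ L ≈ ⟪ k ⟫ L′
⟪⟫-congL input = ≈-Σ
⟪⟫-congL output = ≈-Σ
⟪⟫-congL internal = ≈-⊕

⟪⟫-perm : ∀ k {L L′ : Choice n} → L ↭ L′ → ⟪ k ⟫ L ≈ ⟪ k ⟫ L′
⟪⟫-perm input = ≈-Σperm
⟪⟫-perm output = ≈-Σperm
⟪⟫-perm internal = ≈-⊕perm

label∉ : ∀ {L : Choice n} {a b c} → All (a ≢_) (map proj₁ L) → (b , c) ∈ L → a ≢ b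
label∉ ps c∈ = All.lookup ps (∈-map⁺ proj₁ c∈)

-- The partner of the first summand is moved to the front of `L′`. Distinct names make it the only
-- summand of that name, so the remaining summands still match each other.
Match⇒≈L : {L L′ : Choice n} → Unique (map proj₁ L) → Unique (map proj₁ L′) → Match _≈_ L L′ →
  ∃[ K ] (L ≈L K × K ↭ L′)
Match⇒≈L {L = []} {[]} _ _ _ = [] , [] , ↭-refl
Match⇒≈L {L = []} {x ∷ L′} _ _ (_ , bw) with bw (here refl)
... | _ , () , _
Match⇒≈L {L = (a , c) ∷ L} {L′} (a∉ AllPairs.∷ u) u′ (fw , bw)
  with d , d∈ , c≈d ← fw (here refl)
  with ys , zs , refl ← ∈-∃++ d∈
  with a∉′ AllPairs.∷ u″ ←
    Unique-resp-↭ (setoid Name) (↭⇒↭ₛ (map⁺ proj₁ (shift (a , d) ys zs))) u′ =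
  let π = shift (a , d) ys zs
      K , es , π′ = Match⇒≈L u u″
        ( (λ c∈ → let d′ , d∈ , e = fw (there c∈) in d′ , other a∉ c∈ (∈-resp-↭ π d∈) , e)
        , (λ d∈ → let c′ , c∈ , e = bw (∈-resp-↭ (↭-sym π) (there d∈)) in c′ , other a∉′ d∈ c∈ , e))
  in (a , d) ∷ K , c≈d ∷ es , ↭-trans (prep _ π′) (↭-sym π)
  where
  other : ∀ {a : Name} {b} {c d x : Contract _} {K K′ : Choice _} → All (a ≢_) (map proj₁ K) →
    (b , c) ∈ K → (b , d) ∈ (a , x) ∷ K′ → (b , d) ∈ K′
  other a∉ c∈ (here refl) = ⊥-elim (label∉ a∉ c∈ refl)
  other a∉ c∈ (there d∈) = d∈

Node-match-≈ : ∀ {c d : Contract n} {k L L′} → Node c k L → Node d k L′ → WF c → WF d →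
  Match _≈_ L L′ → c ≈ d
Node-match-≈ {k = k} nc nd wc wd mt
  with wfChoice _ u _ ← WF-node nc wc | wfChoice _ u′ _ ← WF-node nd wd =
  let K , es , π = Match⇒≈L u u′ mt
  in ≈-trans (Node-≈ nc) (≈-trans (⟪⟫-congL k es) (≈-trans (⟪⟫-perm k π) (≈-sym (Node-≈ nd))))

-- Closure of the equivalence under substitution

mutual
  -- Leads back from the open contracts of the comparison: it rebinds a variable opened by `j-rec`,
  -- and finally removes the variable pool.
  ≈-sub : (s : Fin n → Contract m) {c d : Contract n} → c ≈ d → sub s c ≈ sub s d
  ≈-sub s ≈-refl = ≈-refl
  ≈-sub s (≈-sym e) = ≈-sym (≈-sub s e)
  ≈-sub s (≈-trans e f) = ≈-trans (≈-sub s e) (≈-sub s f)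
  ≈-sub s (≈-unfold {b = b}) = ≈-trans ≈-unfold (≡⇒≈
    (trans (unfoldBody≡inst (sub (liftS s) b))
      (trans (sym (sub-unfold s b)) (cong (sub s) (sym (unfoldBody≡inst b))))))
  ≈-sub s (≈-rec e) = ≈-rec (≈-sub (liftS s) e)
  ≈-sub s (≈-Σ es) = ≈-Σ (≈L-subL s es)
  ≈-sub s (≈-⊕ es) = ≈-⊕ (≈L-subL s es)
  ≈-sub s (≈-Σperm {L = L} {L′} π) rewrite subL≡mp s L | subL≡mp s L′ = ≈-Σperm (map⁺ _ π)
  ≈-sub s (≈-⊕perm {L = L} {L′} π) rewrite subL≡mp s L | subL≡mp s L′ = ≈-⊕perm (map⁺ _ π)
  ≈-sub s ≈-unary = ≈-unary

  ≈L-subL : (s : Fin n → Contract m) {L L′ : Choice n} → L ≈L L′ → subL s L ≈L subL s L′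
  ≈L-subL s [] = []
  ≈L-subL s (e ∷ es) = ≈-sub s e ∷ ≈L-subL s es

-- Decidable syntactic equality

infix 4 _≟ᴾ_ _≟ᴷ_ _≟_ _≟L_

_≟ᴾ_ : DecidableEquality Pol
inp ≟ᴾ inp = yes refl
inp ≟ᴾ out = no λ ()
out ≟ᴾ inp = no λ ()
out ≟ᴾ out = yes refl

_≟ᴷ_ : DecidableEquality Kind
input ≟ᴷ input = yes refl
input ≟ᴷ output = no λ ()
input ≟ᴷ internal = no λ ()
output ≟ᴷ input = no λ ()
output ≟ᴷ output = yes refl
output ≟ᴷ internal = no λ ()
internal ≟ᴷ input = no λ ()
internal ≟ᴷ output = no λ ()
internal ≟ᴷ internal = yes refl

mutual
  _≟_ : DecidableEquality (Contract n)
  𝟏 ≟ 𝟏 = yes refl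
  𝟏 ≟ Σ⟨ _ ⟩ _ = no λ ()
  𝟏 ≟ ⊕ _ = no λ ()
  𝟏 ≟ var _ = no λ ()
  𝟏 ≟ rec _ = no λ ()
  Σ⟨ _ ⟩ _ ≟ 𝟏 = no λ ()
  Σ⟨ p ⟩ L ≟ Σ⟨ q ⟩ L′ =
    map′ (λ { (refl , refl) → refl }) (λ { refl → refl , refl }) (p ≟ᴾ q ×-dec L ≟L L′)
  Σ⟨ _ ⟩ _ ≟ ⊕ _ = no λ ()
  Σ⟨ _ ⟩ _ ≟ var _ = no λ ()
  Σ⟨ _ ⟩ _ ≟ rec _ = no λ ()
  ⊕ _ ≟ 𝟏 = no λ ()
  ⊕ _ ≟ Σ⟨ _ ⟩ _ = no λ ()
  ⊕ L ≟ ⊕ L′ = map′ (cong ⊕) (λ { refl → refl }) (L ≟L L′)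
  ⊕ _ ≟ var _ = no λ ()
  ⊕ _ ≟ rec _ = no λ ()
  var _ ≟ 𝟏 = no λ ()
  var _ ≟ Σ⟨ _ ⟩ _ = no λ ()
  var _ ≟ ⊕ _ = no λ ()
  var i ≟ var j = map′ (cong var) (λ { refl → refl }) (i Fin.≟ j)
  var _ ≟ rec _ = no λ ()
  rec _ ≟ 𝟏 = no λ ()
  rec _ ≟ Σ⟨ _ ⟩ _ = no λ ()
  rec _ ≟ ⊕ _ = no λ ()
  rec _ ≟ var _ = no λ ()
  rec b ≟ rec b′ = map′ (cong rec) (λ { refl → refl }) (b ≟ b′)

  _≟L_ : DecidableEquality (Choice n)
  [] ≟L [] = yes refl
  [] ≟L (_ ∷ _) = no λ ()
  (_ ∷ _) ≟L [] = no λ ()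
  ((a , c) ∷ L) ≟L ((b , d) ∷ L′) =
    map′ (λ { (refl , refl , refl) → refl }) (λ { refl → refl , refl , refl })
      (a ℕ.≟ b ×-dec c ≟ d ×-dec L ≟L L′)

-- Deciding statements about the summands of a choice

any-summand? : ∀ {P : Name → A → Set} (L : List (Name × A)) →
  (∀ {a c} → (a , c) ∈ L → Dec (P a c)) → Dec (∃[ a ] ∃[ c ] ((a , c) ∈ L × P a c))
any-summand? [] p? = no λ ()
any-summand? ((a , c) ∷ L) p? =
  map′ (λ { (inj₁ p) → a , c , here refl , p ; (inj₂ (b , d , d∈ , p)) → b , d , there d∈ , p })
       (λ { (_ , _ , here refl , p) → inj₁ p ; (b , d , there d∈ , p) → inj₂ (b , d , d∈ , p) })
       (p? (here refl) ⊎-dec any-summand? L (p? ∘ there))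

summand? : ∀ {Q : A → Set} a (L : List (Name × A)) → (∀ {d} → (a , d) ∈ L → Dec (Q d)) →
  Dec (∃[ d ] ((a , d) ∈ L × Q d))
summand? {Q = Q} a L q? =
  map′ (λ { (_ , d , d∈ , refl , q) → d , d∈ , q }) (λ { (d , d∈ , q) → a , d , d∈ , refl , q })
       (any-summand? L named?)
  where
  named? : ∀ {b d} → (b , d) ∈ L → Dec (a ≡ b × Q d)
  named? {b} d∈ with a ℕ.≟ b
  ... | no a≢b = no (a≢b ∘ proj₁)
  ... | yes refl = map′ (refl ,_) proj₂ (q? d∈)

all-summands? : ∀ {P : Name → A → Set} (L : List (Name × A)) →
  (∀ {a c} → (a , c) ∈ L → Dec (P a c)) → Dec (∀ {a c} → (a , c) ∈ L → P a c)
all-summands? [] p? = yes λ ()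
all-summands? ((a , c) ∷ L) p? with p? (here refl) | all-summands? L (p? ∘ there)
... | no ¬p | _ = no λ ps → ¬p (ps (here refl))
... | yes _ | no ¬ps = no λ ps → ¬ps (λ c∈ → ps (there c∈))
... | yes p | yes ps = yes λ { (here refl) → p ; (there c∈) → ps c∈ }

Match? : ∀ {X : A → B → Set} → (∀ c d → Dec (X c d)) → ∀ L L′ → Dec (Match X L L′)
Match? x? L L′ =
  all-summands? L (λ {a} {c} _ → summand? a L′ (λ {d} _ → x? c d)) ×-dec
  all-summands? L′ (λ {a} {d} _ → summand? a L (λ {c} _ → x? c d))

-- Joinability as a finitary inductive definition

infix 4 _⟶_

data _⟶_ {n : ℕ} : Contract n → Contract n → Set where
  arg : ∀ {c k L a d} → Node c k L → (a , d) ∈ L → c ⟶ d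
  unfold : ∀ {b} → rec b ⟶ inst (rec b) b
  open-with : ∀ {b} i → rec b ⟶ inst (var i) b

abstract-var : Fin n → Fin n → Contract (suc n)
abstract-var i j with j Fin.≟ i
... | yes _ = var zero
... | no _ = var (suc j)

-- The variable i does not occur in rec b.
Closable : Fin n → Contract (suc n) → Set
Closable i b = sub (abstract-var i) (inst (var i) b) ≡ b

-- Instead of comparing the bodies of two recursions in a larger scope, their bound variables
-- are replaced by the same unused variable, so that all comparisons stay in one scope.
data JoinStep {n : ℕ} (X : Contract n → Contract n → Set) : Contract n → Contract n → Set where
  j-𝟏 : JoinStep X 𝟏 𝟏
  j-var : ∀ {i} → JoinStep X (var i) (var i)
  j-node : ∀ {c d k L L′} → Node c k L → Node d k L′ → Match X L L′ → JoinStep X c d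
  j-rec : ∀ {b b′} i → Closable i b → Closable i b′ → X (inst (var i) b) (inst (var i) b′) →
    JoinStep X (rec b) (rec b′)
  j-unfoldˡ : ∀ {b d} → X (inst (rec b) b) d → JoinStep X (rec b) d
  j-unfoldʳ : ∀ {c b} → X c (inst (rec b) b) → JoinStep X c (rec b)

data Join {n : ℕ} : Contract n → Contract n → Set where
  join : ∀ {c d} → JoinStep Join c d → Join c d

Join⇒≈ : {c d : Contract n} → WF c → WF d → Join c d → c ≈ d
Join⇒≈ wc wd (join j-𝟏) = ≈-refl
Join⇒≈ wc wd (join j-var) = ≈-refl
Join⇒≈ wc wd (join (j-node nc nd (fw , bw))) = Node-match-≈ nc nd wc wd
  ( (λ c∈ → let d , d∈ , r = fw c∈
            in d , d∈ , Join⇒≈ (WF-∈ (WF-node nc wc) c∈) (WF-∈ (WF-node nd wd) d∈) r)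
  , (λ d∈ → let c , c∈ , r = bw d∈
            in c , c∈ , Join⇒≈ (WF-∈ (WF-node nc wc) c∈) (WF-∈ (WF-node nd wd) d∈) r))
Join⇒≈ wc wd (join (j-rec i cl cl′ r)) = ≈-rec
  (≈-trans (≡⇒≈ (sym cl)) (≈-trans
    (≈-sub (abstract-var i) (Join⇒≈ (WF-inst wf-var (WF-body wc)) (WF-inst wf-var (WF-body wd)) r))
    (≡⇒≈ cl′)))
Join⇒≈ wc wd (join (j-unfoldˡ {b} r)) =
  ≈-trans ≈-unfold (≈-trans (≡⇒≈ (unfoldBody≡inst b)) (Join⇒≈ (WF-unfold wc) wd r))
Join⇒≈ wc wd (join (j-unfoldʳ {b = b} r)) =
  ≈-trans (Join⇒≈ wc (WF-unfold wd) r) (≈-trans (≡⇒≈ (sym (unfoldBody≡inst b))) (≈-sym ≈-unfold))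

-- Monotonicity, sharpened: the premises only concern pairs at most one `_⟶_` step away on each
-- side. So on a closed set of pairs the rules never look outside it.
JoinStep-map : {X Y : Contract n → Contract n → Set} {c d : Contract n} →
  (∀ {c′ d′} → ReflClosure _⟶_ c c′ → ReflClosure _⟶_ d d′ → X c′ d′ → Y c′ d′) →
  JoinStep X c d → JoinStep Y c d
JoinStep-map f j-𝟏 = j-𝟏
JoinStep-map f j-var = j-var
JoinStep-map f (j-node nc nd (fw , bw)) = j-node nc nd
  ( (λ c∈ → let d , d∈ , x = fw c∈ in d , d∈ , f [ arg nc c∈ ] [ arg nd d∈ ] x)
  , (λ d∈ → let c , c∈ , x = bw d∈ in c , c∈ , f [ arg nc c∈ ] [ arg nd d∈ ] x))
JoinStep-map f (j-rec i cl cl′ x) = j-rec i cl cl′ (f [ open-with i ] [ open-with i ] x)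
JoinStep-map f (j-unfoldˡ x) = j-unfoldˡ (f [ unfold ] refl x)
JoinStep-map f (j-unfoldʳ x) = j-unfoldʳ (f refl [ unfold ] x)

node? : (c : Contract n) → Dec (∃[ k ] ∃[ L ] Node c k L)
node? 𝟏 = no λ ()
node? (Σ⟨ p ⟩ L) = yes (_ , L , Σ-node refl)
node? (⊕ L) = yes (_ , L , ⊕-node)
node? (var _) = no λ ()
node? (rec _) = no λ ()

rec? : (c : Contract n) → Dec (∃[ b ] c ≡ rec b)
rec? 𝟏 = no λ ()
rec? (Σ⟨ _ ⟩ _) = no λ ()
rec? (⊕ _) = no λ ()
rec? (var _) = no λ ()
rec? (rec b) = yes (b , refl)

var? : (c : Contract n) → Dec (∃[ i ] c ≡ var i)
var? 𝟏 = no λ ()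
var? (Σ⟨ _ ⟩ _) = no λ ()
var? (⊕ _) = no λ ()
var? (var i) = yes (i , refl)
var? (rec _) = no λ ()

module _ {X : Contract n → Contract n → Set} (x? : ∀ c d → Dec (X c d)) where

  private
    NodeCase VarCase RecCase UnfoldˡCase UnfoldʳCase : Contract n → Contract n → Set
    NodeCase c d = ∃[ k ] ∃[ L ] ∃[ L′ ] (Node c k L × Node d k L′ × Match X L L′)
    VarCase c d = ∃[ i ] (c ≡ var i × d ≡ var i)
    RecCase c d = ∃[ b ] ∃[ b′ ] (c ≡ rec b × d ≡ rec b′ ×
      ∃[ i ] (Closable i b × Closable i b′ × X (inst (var i) b) (inst (var i) b′)))
    UnfoldˡCase c d = ∃[ b ] (c ≡ rec b × X (inst (rec b) b) d)
    UnfoldʳCase c d = ∃[ b ] (d ≡ rec b × X c (inst (rec b) b))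

    nodeCase? : ∀ c d → Dec (NodeCase c d)
    nodeCase? c d with node? c | node? d
    ... | no ¬c | _ = no λ { (k , L , _ , nc , _) → ¬c (k , L , nc) }
    ... | yes _ | no ¬d = no λ { (k , _ , L , _ , nd , _) → ¬d (k , L , nd) }
    ... | yes (k , L , nc) | yes (k′ , L′ , nd) with k ≟ᴷ k′
    ... | no k≢ = no λ { (_ , _ , _ , nc′ , nd′ , _) →
          k≢ (trans (proj₁ (Node-unique nc nc′)) (proj₁ (Node-unique nd′ nd))) }
    ... | yes refl = map′ (λ mt → k , L , L′ , nc , nd , mt)
          (λ { (_ , _ , _ , nc′ , nd′ , mt) →
            subst₂ (Match X) (proj₂ (Node-unique nc′ nc)) (proj₂ (Node-unique nd′ nd)) mt })
          (Match? x? L L′)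

    varCase? : ∀ c d → Dec (VarCase c d)
    varCase? c d with var? c
    ... | no ¬c = no λ { (i , eq , _) → ¬c (i , eq) }
    ... | yes (i , refl) = map′ (λ eq → i , refl , eq) (λ { (_ , refl , eq) → eq }) (d ≟ var i)

    recCase? : ∀ c d → Dec (RecCase c d)
    recCase? c d with rec? c | rec? d
    ... | no ¬c | _ = no λ { (b , _ , eq , _) → ¬c (b , eq) }
    ... | yes _ | no ¬d = no λ { (_ , b , _ , eq , _) → ¬d (b , eq) }
    ... | yes (b , refl) | yes (b′ , refl) =
      map′ (λ h → b , b′ , refl , refl , h) (λ { (_ , _ , refl , refl , h) → h })
        (Fin.any? (λ i → (_ ≟ b) ×-dec (_ ≟ b′) ×-dec x? _ _))

    unfoldˡCase? : ∀ c d → Dec (UnfoldˡCase c d)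
    unfoldˡCase? c d with rec? c
    ... | no ¬c = no λ { (b , eq , _) → ¬c (b , eq) }
    ... | yes (b , refl) = map′ (λ x → b , refl , x) (λ { (_ , refl , x) → x }) (x? _ d)

    unfoldʳCase? : ∀ c d → Dec (UnfoldʳCase c d)
    unfoldʳCase? c d with rec? d
    ... | no ¬d = no λ { (b , eq , _) → ¬d (b , eq) }
    ... | yes (b , refl) = map′ (λ x → b , refl , x) (λ { (_ , refl , x) → x }) (x? c _)

  JoinStep? : ∀ c d → Dec (JoinStep X c d)
  JoinStep? c d = map′
    (λ { (inj₁ (refl , refl)) → j-𝟏
       ; (inj₂ (inj₁ (_ , refl , refl))) → j-var
       ; (inj₂ (inj₂ (inj₁ (_ , _ , _ , nc , nd , mt)))) → j-node nc nd mt
       ; (inj₂ (inj₂ (inj₂ (inj₁ (_ , _ , refl , refl , i , cl , cl′ , x))))) → j-rec i cl cl′ x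
       ; (inj₂ (inj₂ (inj₂ (inj₂ (inj₁ (_ , refl , x)))))) → j-unfoldˡ x
       ; (inj₂ (inj₂ (inj₂ (inj₂ (inj₂ (_ , refl , x)))))) → j-unfoldʳ x })
    (λ { j-𝟏 → inj₁ (refl , refl)
       ; j-var → inj₂ (inj₁ (_ , refl , refl))
       ; (j-node nc nd mt) → inj₂ (inj₂ (inj₁ (_ , _ , _ , nc , nd , mt)))
       ; (j-rec i cl cl′ x) → inj₂ (inj₂ (inj₂ (inj₁ (_ , _ , refl , refl , i , cl , cl′ , x))))
       ; (j-unfoldˡ x) → inj₂ (inj₂ (inj₂ (inj₂ (inj₁ (_ , refl , x)))))
       ; (j-unfoldʳ x) → inj₂ (inj₂ (inj₂ (inj₂ (inj₂ (_ , refl , x))))) })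
    ((c ≟ 𝟏 ×-dec d ≟ 𝟏) ⊎-dec varCase? c d ⊎-dec nodeCase? c d ⊎-dec recCase? c d
      ⊎-dec unfoldˡCase? c d ⊎-dec unfoldʳCase? c d)

-- Stabilisation of an increasing chain of decidable predicates on a finite list

filter-length-≤ : {P Q : A → Set} (P? : Decidable P) (Q? : Decidable Q) → (∀ {x} → P x → Q x) →
  ∀ U → length (filter P? U) ≤ length (filter Q? U)
filter-length-≤ P? Q? P⊆Q [] = z≤n
filter-length-≤ P? Q? P⊆Q (x ∷ U) with P? x | Q? x
... | yes _ | yes _ = s≤s (filter-length-≤ P? Q? P⊆Q U)
... | yes p | no ¬q = ⊥-elim (¬q (P⊆Q p))
... | no _ | yes _ = ℕ.m≤n⇒m≤1+n (filter-length-≤ P? Q? P⊆Q U)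
... | no _ | no _ = filter-length-≤ P? Q? P⊆Q U

filter-length-< : {P Q : A → Set} (P? : Decidable P) (Q? : Decidable Q) → (∀ {x} → P x → Q x) →
  ∀ U → (∀ {x} → x ∈ U → Q x → P x) ⊎ length (filter P? U) < length (filter Q? U)
filter-length-< P? Q? P⊆Q [] = inj₁ λ ()
filter-length-< P? Q? P⊆Q (x ∷ U) with P? x | Q? x | filter-length-< P? Q? P⊆Q U
... | yes p | no ¬q | _ = ⊥-elim (¬q (P⊆Q p))
... | no _ | yes _ | _ = inj₂ (s≤s (filter-length-≤ P? Q? P⊆Q U))
... | yes p | yes _ | inj₁ eq = inj₁ λ { (here refl) _ → p ; (there x∈) → eq x∈ }
... | yes _ | yes _ | inj₂ lt = inj₂ (s≤s lt)
... | no _ | no ¬q | inj₁ eq = inj₁ λ { (here refl) q → ⊥-elim (¬q q) ; (there x∈) → eq x∈ }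
... | no _ | no _ | inj₂ lt = inj₂ lt

module _ {P : ℕ → A → Set} (P? : ∀ k → Decidable (P k)) (U : List A)
  (increasing : ∀ k {x} → P k x → P (suc k) x) where

  private
    Stable : ℕ → Set
    Stable k = ∀ {x} → x ∈ U → P (suc k) x → P k x

  -- Pigeonhole: each stage that is not stable gains an entry of `U`, so a stable one occurs by
  -- stage `length U`. `persist` carries stability on from an earlier stage.
  stabilises : (∀ k → Stable k → Stable (suc k)) → Stable (length U)
  stabilises persist with grows (length U)
    where
    grows : ∀ k → Stable k ⊎ k < length (filter (P? (suc k)) U)
    grows zero with filter-length-< (P? 0) (P? 1) (increasing 0) U
    ... | inj₁ st = inj₁ st
    ... | inj₂ lt = inj₂ (ℕ.≤-<-trans z≤n lt)
    grows (suc k) with grows k | filter-length-< (P? (suc k)) (P? (suc (suc k))) (increasing (suc k)) U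
    ... | inj₁ st | _ = inj₁ (persist k st)
    ... | inj₂ _ | inj₁ st = inj₁ st
    ... | inj₂ k< | inj₂ lt = inj₂ (ℕ.≤-<-trans k< lt)
  ... | inj₁ st = st
  ... | inj₂ lt = ⊥-elim (ℕ.<⇒≱ lt (length-filter (P? (suc (length U))) U))

-- Deciding joinability on finite closed sets

Closed : List (Contract n) → Set
Closed XS = ∀ {c d} → c ∈ XS → c ⟶ d → d ∈ XS

Closed-refl : {XS : List (Contract n)} → Closed XS → ∀ {c d} → c ∈ XS → ReflClosure _⟶_ c d → d ∈ XS
Closed-refl cl c∈ refl = c∈
Closed-refl cl c∈ [ st ] = cl c∈ st

Join^ : ℕ → Contract n → Contract n → Set
Join^ zero _ _ = ⊥
Join^ (suc k) = JoinStep (Join^ k)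

Join^? : ∀ k (c d : Contract n) → Dec (Join^ k c d)
Join^? zero c d = no λ ()
Join^? (suc k) = JoinStep? (Join^? k)

Join^⇒Join : ∀ k {c d : Contract n} → Join^ k c d → Join c d
Join^⇒Join (suc k) x = join (JoinStep-map (λ _ _ → Join^⇒Join k) x)

Join^-increasing : ∀ k {c d : Contract n} → Join^ k c d → Join^ (suc k) c d
Join^-increasing (suc k) = JoinStep-map (λ _ _ → Join^-increasing k)

module _ {XS YS : List (Contract n)} (clˡ : Closed XS) (clʳ : Closed YS) where

  private
    U = cartesianProduct XS YS

    stable : ∀ {x} → x ∈ U → uncurry (Join^ (suc (length U))) x → uncurry (Join^ (length U)) x
    stable = stabilises {P = λ k → uncurry (Join^ k)} (λ k x → Join^? k (proj₁ x) (proj₂ x)) U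
      (λ k → Join^-increasing k)
      λ k st {x} x∈ → let c∈ , d∈ = ∈-cartesianProduct⁻ XS YS x∈ in JoinStep-map λ r s →
        st (∈-cartesianProduct⁺ (Closed-refl clˡ c∈ r) (Closed-refl clʳ d∈ s))

  -- Induction on the derivation: its premises lie in approximant `length U`, so its conclusion lies
  -- in the next one, which adds nothing on `U`.
  Join⇒Join^ : ∀ {c d} → c ∈ XS → d ∈ YS → Join c d → Join^ (length U) c d
  Join⇒Join^ c∈ d∈ (join x) = stable (∈-cartesianProduct⁺ c∈ d∈) (step x)
    where
    step : JoinStep Join _ _ → JoinStep (Join^ (length U)) _ _
    step j-𝟏 = j-𝟏
    step j-var = j-var
    step (j-node nc nd (fw , bw)) = j-node nc nd
      ( (λ x∈ → let y , y∈ , r = fw x∈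
                in y , y∈ , Join⇒Join^ (clˡ c∈ (arg nc x∈)) (clʳ d∈ (arg nd y∈)) r)
      , (λ y∈ → let x , x∈ , r = bw y∈
                in x , x∈ , Join⇒Join^ (clˡ c∈ (arg nc x∈)) (clʳ d∈ (arg nd y∈)) r))
    step (j-rec i cl cl′ r) =
      j-rec i cl cl′ (Join⇒Join^ (clˡ c∈ (open-with i)) (clʳ d∈ (open-with i)) r)
    step (j-unfoldˡ r) = j-unfoldˡ (Join⇒Join^ (clˡ c∈ unfold) d∈ r)
    step (j-unfoldʳ r) = j-unfoldʳ (Join⇒Join^ c∈ (clʳ d∈ unfold) r)

  Join? : ∀ {c d} → c ∈ XS → d ∈ YS → Dec (Join c d)
  Join? {c} {d} c∈ d∈ =
    map′ (Join^⇒Join (length U)) (Join⇒Join^ c∈ d∈) (Join^? (length U) c d)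

-- The finitely many contracts reachable from a contract

module _ {N : ℕ} where

  mutual
    -- The analogue of the Fischer-Ladner closure: every reachable contract is a subterm `c` of the
    -- original under an environment `θ`. Unfolding merely adds the recursion to `θ`, so the
    -- construction is structural in `c`.
    states : Contract n → (Fin n → Contract N) → List (Contract N)
    states c θ = sub θ c ∷ inner c θ

    -- A variable contributes nothing: the successors of `θ i` are collected where `θ i` entered the
    -- environment.
    inner : Contract n → (Fin n → Contract N) → List (Contract N)
    inner 𝟏 θ = []
    inner (Σ⟨ p ⟩ L) θ = statesL L θ
    inner (⊕ L) θ = statesL L θ
    inner (var i) θ = []
    inner (rec b) θ =
      states b (sub θ (rec b) ◂ θ) ++ concatMap (λ i → states b (var i ◂ θ)) (allFin N)

    statesL : Choice n → (Fin n → Contract N) → List (Contract N)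
    statesL [] θ = []
    statesL ((a , c) ∷ L) θ = states c θ ++ statesL L θ

  states-arg : ∀ {L : Choice n} {θ a d} → (a , d) ∈ subL θ L → d ∈ statesL L θ
  states-arg {L = _ ∷ _} (here refl) = here refl
  states-arg {L = (_ , c) ∷ _} {θ} (there d∈) = ∈-++⁺ʳ (states c θ) (states-arg d∈)

  rec-step : ∀ {b : Contract (suc n)} {θ : Fin n → Contract N} {t} →
    rec (sub (liftS θ) b) ⟶ t → t ∈ inner (rec b) θ
  rec-step {b = b} {θ} unfold =
    ∈-++⁺ˡ {xs = states b (sub θ (rec b) ◂ θ)} (here (sym (sub-◂ (sub θ (rec b)) θ b)))
  rec-step {b = b} {θ} (open-with i) = ∈-++⁺ʳ (states b (sub θ (rec b) ◂ θ))
    (∈-concatMap⁺ (λ i → states b (var i ◂ θ)) (lose (∈-allFin i) (here (sym (sub-◂ (var i) θ b)))))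

  mutual
    -- A variable leads to the successors of `θ i`, which belong to an enclosing contract. Hence an
    -- arbitrary `P` in place of membership, with the steps of the environment as a hypothesis.
    states-step : ∀ (c : Contract n) θ {P : Contract N → Set} → (∀ {t} → t ∈ inner c θ → P t) →
      (∀ i {t} → θ i ⟶ t → P t) → ∀ {t t′} → t ∈ states c θ → t ⟶ t′ → P t′
    states-step 𝟏 θ inP θP (here refl) (arg () _)
    states-step (Σ⟨ p ⟩ L) θ inP θP (here refl) (arg (Σ-node _) d∈) = inP (states-arg d∈)
    states-step (Σ⟨ p ⟩ L) θ inP θP (there t∈) = statesL-step L θ inP θP t∈
    states-step (⊕ L) θ inP θP (here refl) (arg ⊕-node d∈) = inP (states-arg d∈)
    states-step (⊕ L) θ inP θP (there t∈) = statesL-step L θ inP θP t∈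
    states-step (var i) θ inP θP (here refl) st = θP i st
    states-step (rec b) θ inP θP (here refl) st = inP (rec-step {b = b} st)
    states-step (rec b) θ inP θP (there t∈) st
      with ∈-++⁻ (states b (sub θ (rec b) ◂ θ)) t∈
    ... | inj₁ t∈ = states-step b _ (inP ∘ ∈-++⁺ˡ ∘ there)
          -- The new entry of the environment is the recursion itself, whose steps are already in
          -- `inner (rec b) θ`.
          (λ { zero st → inP (rec-step {b = b} st) ; (suc i) → θP i }) t∈ st
    ... | inj₂ t∈ with Any.satisfied (∈-concatMap⁻ (λ i → states b (var i ◂ θ)) {xs = allFin N} t∈)
    ... | i , t∈ = states-step b _
          (λ u∈ → inP (∈-++⁺ʳ (states b (sub θ (rec b) ◂ θ))
            (∈-concatMap⁺ (λ i → states b (var i ◂ θ)) (lose (∈-allFin i) (there u∈)))))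
          (λ { zero (arg () _) ; (suc j) → θP j }) t∈ st

    statesL-step : ∀ (L : Choice n) θ {P : Contract N → Set} → (∀ {t} → t ∈ statesL L θ → P t) →
      (∀ i {t} → θ i ⟶ t → P t) → ∀ {t t′} → t ∈ statesL L θ → t ⟶ t′ → P t′
    statesL-step ((a , c) ∷ L) θ inP θP t∈ st with ∈-++⁻ (states c θ) t∈
    ... | inj₁ t∈ = states-step c θ (inP ∘ there ∘ ∈-++⁺ˡ) θP t∈ st
    ... | inj₂ t∈ = statesL-step L θ (inP ∘ ∈-++⁺ʳ (states c θ)) θP t∈ st

reachable : Contract n → List (Contract n)
reachable c = states c var

∈-reachable : (c : Contract n) → c ∈ reachable c
∈-reachable c = here (sym (sub-var (λ _ → refl) c))

reachable-closed : (c : Contract n) → Closed (reachable c)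
reachable-closed c = states-step c var there λ { i (arg () _) }

-- Fresh variables

-- Non-occurrence in semantic form, so that it passes through substitution by composing
-- substitutions, without a new induction on contracts.
Fresh : Fin n → Contract n → Set
Fresh {n} i c = ∀ {m} {σ τ : Fin n → Contract m} → (∀ j → j ≢ i → σ j ≡ τ j) → sub σ c ≡ sub τ c

Fresh-var : {i j : Fin n} → j ≢ i → Fresh i (var j)
Fresh-var j≢i eq = eq _ j≢i

Fresh-sub : {θ : Fin n → Contract m} {i : Fin m} → (∀ j → Fresh i (θ j)) → ∀ c → Fresh i (sub θ c)
Fresh-sub {θ = θ} fr c {σ = σ} {τ} eq =
  trans (sub-sub σ θ c) (trans (sub-cong (λ j → fr j eq) c) (sym (sub-sub τ θ c)))

-- `abstract-var i` and the plain shift differ only at `i`, so they agree on `rec b`; on the body,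
-- `merge` undoes the shift.
Fresh⇒Closable : {i : Fin n} {b : Contract (suc n)} → Fresh i (rec b) → Closable i b
Fresh⇒Closable {n} {i} {b} fr = begin
  sub (abstract-var i) (inst (var i) b) ≡⟨ sub-sub (abstract-var i) (var i ◂ var) b ⟩
  sub (sub (abstract-var i) ∘ (var i ◂ var)) b ≡⟨ sub-cong merged b ⟩
  sub (sub merge ∘ liftS (abstract-var i)) b ≡⟨ sub-sub merge (liftS (abstract-var i)) b ⟨
  sub merge (sub (liftS (abstract-var i)) b) ≡⟨ cong (sub merge) (rec-injective (fr away)) ⟩
  sub merge (sub (liftS (var ∘ suc)) b) ≡⟨ sub-sub merge (liftS (var ∘ suc)) b ⟩
  sub (sub merge ∘ liftS (var ∘ suc)) b ≡⟨ sub-var (λ { zero → refl ; (suc _) → refl }) b ⟩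
  b ∎
  where
  open ≡-Reasoning
  -- Under the binder, index 0 is the bound variable of `rec b` and index 1 the one introduced by
  -- `abstract-var i`; instantiating with `i` and abstracting again amounts to identifying them.
  merge : Fin (suc (suc n)) → Contract (suc n)
  merge zero = var zero
  merge (suc zero) = var zero
  merge (suc (suc j)) = var (suc j)
  rec-injective : ∀ {m} {c d : Contract (suc m)} → rec c ≡ rec d → c ≡ d
  rec-injective refl = refl
  away : ∀ j → j ≢ i → abstract-var i j ≡ var (suc j)
  away j j≢i with j Fin.≟ i
  ... | yes j≡i = ⊥-elim (j≢i j≡i)
  ... | no _ = refl
  merged : sub (abstract-var i) ∘ (var i ◂ var) ≗ sub merge ∘ liftS (abstract-var i)
  merged zero with i Fin.≟ i
  ... | yes _ = refl
  ... | no i≢i = ⊥-elim (i≢i refl)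
  merged (suc j) with j Fin.≟ i
  ... | yes _ = refl
  ... | no _ = refl

mutual
  recs : Contract n → ℕ
  recs 𝟏 = 0
  recs (Σ⟨ p ⟩ L) = recsL L
  recs (⊕ L) = recsL L
  recs (var i) = 0
  recs (rec b) = suc (recs b)

  recsL : Choice n → ℕ
  recsL [] = 0
  recsL ((a , c) ∷ L) = recs c + recsL L

FreshOff : List (Fin n) → Contract n → Set
FreshOff is c = ∀ {i} → i ∉ is → Fresh i c

mutual
  -- Unfolding brings in a contract built from `θ`, hence no new variable; opening brings in one. On
  -- the way to a state each `rec` of `c` is entered at most once, which gives the bound.
  states-fresh : ∀ (c : Contract n) (θ : Fin n → Contract N) is → (∀ j → FreshOff is (θ j)) →
    ∀ {t} → t ∈ states c θ → ∃[ js ] (length js ≤ length is + recs c × FreshOff js t)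
  states-fresh c θ is fr (here refl) = is , ℕ.m≤m+n _ _ , λ i∉ → Fresh-sub (λ j → fr j i∉) c
  states-fresh (Σ⟨ p ⟩ L) θ is fr (there t∈) = statesL-fresh L θ is fr t∈
  states-fresh (⊕ L) θ is fr (there t∈) = statesL-fresh L θ is fr t∈
  states-fresh {N = N} (rec b) θ is fr (there t∈) with ∈-++⁻ (states b (sub θ (rec b) ◂ θ)) t∈
  ... | inj₁ t∈ =
    let js , le , fr′ = states-fresh b _ is
          (λ { zero i∉ → Fresh-sub (λ j → fr j i∉) (rec b) ; (suc j) → fr j }) t∈
    in js , ℕ.≤-trans le (ℕ.+-monoʳ-≤ (length is) (ℕ.n≤1+n _)) , fr′
  ... | inj₂ t∈ with Any.satisfied (∈-concatMap⁻ (λ i → states b (var i ◂ θ)) {xs = allFin N} t∈)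
  ... | i , t∈ =
    let js , le , fr′ = states-fresh b _ (i ∷ is)
          (λ { zero k∉ → Fresh-var (λ { refl → k∉ (here refl) })
             ; (suc j) k∉ → fr j (k∉ ∘ there) }) t∈
    in js , subst (length js ≤_) (sym (ℕ.+-suc (length is) (recs b))) le , fr′

  statesL-fresh : ∀ (L : Choice n) (θ : Fin n → Contract N) is → (∀ j → FreshOff is (θ j)) →
    ∀ {t} → t ∈ statesL L θ → ∃[ js ] (length js ≤ length is + recsL L × FreshOff js t)
  statesL-fresh ((a , c) ∷ L) θ is fr t∈ with ∈-++⁻ (states c θ) t∈
  ... | inj₁ t∈ =
    let js , le , fr′ = states-fresh c θ is fr t∈
    in js , ℕ.≤-trans le (ℕ.+-monoʳ-≤ (length is) (ℕ.m≤m+n (recs c) _)) , fr′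
  ... | inj₂ t∈ =
    let js , le , fr′ = statesL-fresh L θ is fr t∈
    in js , ℕ.≤-trans le (ℕ.+-monoʳ-≤ (length is) (ℕ.m≤n+m _ (recs c))) , fr′

∃-∉ : (is : List (Fin n)) → length is < n → ∃[ i ] i ∉ is
∃-∉ {n} is lt = Fin.¬∀⟶∃¬ n (_∈ is) (λ i → Any.any? (i Fin.≟_) is) λ all →
  ℕ.<⇒≱ lt (Fin.injective⇒≤ {f = λ i → Any.index (all i)}
    (λ {i} {j} → index-injective (setoid (Fin n)) (all i) (all j)))

-- Joinable contracts pass the comparison

module _ {XS YS : List (Contract N)} (clˡ : Closed XS) (clʳ : Closed YS)
  (∃-fresh : ∀ {c d} → c ∈ XS → d ∈ YS → ∃[ i ] (Fresh i c × Fresh i d)) where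

  -- Both reductions are standard, so following them from the root yields the comparison. `ρ` places
  -- the binders entered so far in the pool; it need not be injective, because a pool variable may
  -- be taken again once it no longer occurs.
  ↠⇒Join : {c d e : Contract n} → c ↠ e → d ↠ e → (ρ : Fin n → Fin N) →
    ren ρ c ∈ XS → ren ρ d ∈ YS → Join (ren ρ c) (ren ρ d)
  ↠⇒Join (↠-unfold {b = b} r) s ρ c∈ d∈ = join (j-unfoldˡ
    (subst (λ c → Join c _) (ren-inst ρ (rec b) b)
      (↠⇒Join r s ρ (subst (_∈ XS) (sym (ren-inst ρ (rec b) b)) (clˡ c∈ unfold)) d∈)))
  ↠⇒Join r (↠-unfold {b = b} s) ρ c∈ d∈ = join (j-unfoldʳ
    (subst (Join _) (ren-inst ρ (rec b) b)
      (↠⇒Join r s ρ c∈ (subst (_∈ YS) (sym (ren-inst ρ (rec b) b)) (clʳ d∈ unfold)))))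
  ↠⇒Join ↠-𝟏 ↠-𝟏 ρ c∈ d∈ = join j-𝟏
  ↠⇒Join ↠-var ↠-var ρ c∈ d∈ = join j-var
  ↠⇒Join (↠-node nc ne (fw , bw)) (↠-node nd ne′ (fw′ , bw′)) ρ c∈ d∈
    with refl , refl ← Node-unique ne ne′ =
    join (j-node (Node-ren ρ nc) (Node-ren ρ nd) (Match-mp (ren ρ) (ren ρ)
      ( (λ x∈ → let z , z∈ , r = fw x∈ ; y , y∈ , s = bw′ z∈
                in y , y∈ , ↠⇒Join r s ρ (argˡ x∈) (argʳ y∈))
      , (λ y∈ → let z , z∈ , s = fw′ y∈ ; x , x∈ , r = bw z∈
                in x , x∈ , ↠⇒Join r s ρ (argˡ x∈) (argʳ y∈)))))
    where
    argˡ : ∀ {a x} → (a , x) ∈ _ → ren ρ x ∈ XS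
    argˡ x∈ = clˡ c∈ (arg (Node-ren ρ nc) (∈-mp⁺ (ren ρ) x∈))
    argʳ : ∀ {a x} → (a , x) ∈ _ → ren ρ x ∈ YS
    argʳ x∈ = clʳ d∈ (arg (Node-ren ρ nd) (∈-mp⁺ (ren ρ) x∈))
  ↠⇒Join (↠-rec {b = b} r) (↠-rec {b = b′} s) ρ c∈ d∈ with ∃-fresh c∈ d∈
  ... | i , frˡ , frʳ = join (j-rec i (Fresh⇒Closable frˡ) (Fresh⇒Closable frʳ)
    (subst₂ Join (sym (opened b)) (sym (opened b′)) (↠⇒Join r s ρ′
      (subst (_∈ XS) (opened b) (clˡ c∈ (open-with i)))
      (subst (_∈ YS) (opened b′) (clʳ d∈ (open-with i))))))
    where
    ρ′ : Fin (suc _) → Fin N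
    ρ′ zero = i
    ρ′ (suc j) = ρ j
    opened : ∀ b → inst (var i) (ren (liftR ρ) b) ≡ ren ρ′ b
    opened b = trans (sub-ren (var i ◂ var) (liftR ρ) b)
      (trans (sub-cong (λ { zero → refl ; (suc j) → refl }) b) (sym (ren≗sub ρ′ b)))

-- Deciding the equivalence of closed contracts

module _ (c d : Contract 0) where

  private
    -- A state of `c` contains at most `recs c` pool variables and a state of `d` at most `recs d`;
    -- one more leaves a variable fresh for both.
    pool : ℕ
    pool = suc (recs c + recs d)

    widen : Contract 0 → Contract pool
    widen = ren λ ()

    narrow : Contract pool → Contract 0
    narrow = sub λ _ → 𝟏

    narrow-widen : ∀ x → narrow (widen x) ≡ x
    narrow-widen x = trans (sub-ren _ _ x) (sub-var (λ ()) x)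

    states₀ : Contract 0 → List (Contract pool)
    states₀ x = states x λ ()

    closed : ∀ x → Closed (states₀ x)
    closed x = states-step x _ there λ ()

    widen∈ : ∀ x → widen x ∈ states₀ x
    widen∈ x = here (trans (ren≗sub _ x) (sub-cong (λ ()) x))

    ∃-fresh : ∀ {x y} → x ∈ states₀ c → y ∈ states₀ d → ∃[ i ] (Fresh i x × Fresh i y)
    ∃-fresh x∈ y∈ =
      let is , le , fr = states-fresh c _ [] (λ ()) x∈
          js , le′ , fr′ = states-fresh d _ [] (λ ()) y∈
          i , i∉ = ∃-∉ (is ++ js)
            (s≤s (subst (_≤ recs c + recs d) (sym (length-++ is)) (ℕ.+-mono-≤ le le′)))
      in i , fr (i∉ ∘ ∈-++⁺ˡ) , fr′ (i∉ ∘ ∈-++⁺ʳ is)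

    Join⇒≈₀ : WF c → WF d → Join (widen c) (widen d) → c ≈ d
    Join⇒≈₀ wc wd r = subst₂ _≈_ (narrow-widen c) (narrow-widen d)
      (≈-sub _ (Join⇒≈ (WF-ren _ wc) (WF-ren _ wd) r))

    ⋈⇒Join : c ⋈ d → Join (widen c) (widen d)
    ⋈⇒Join (_ , r , s) = ↠⇒Join (closed c) (closed d) ∃-fresh r s _ (widen∈ c) (widen∈ d)

  ⋈⇒≈ : WF c → WF d → c ⋈ d → c ≈ d
  ⋈⇒≈ wc wd = Join⇒≈₀ wc wd ∘ ⋈⇒Join

  ≈? : WF c → WF d → Dec (c ≈ d)
  ≈? wc wd = map′ (Join⇒≈₀ wc wd) (⋈⇒Join ∘ ≈⇒⋈)
    (Join? (closed c) (closed d) (widen∈ c) (widen∈ d))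

-- Head normal forms

data Head {n : ℕ} : Contract n → Set where
  head-𝟏 : Head 𝟏
  head-node : ∀ {c k L} → Node c k L → Head c

infix 4 _⇓_

data _⇓_ {n : ℕ} : Contract n → Contract n → Set where
  done : ∀ {c} → Head c → c ⇓ c
  unfold : ∀ {b u} → inst (rec b) b ⇓ u → rec b ⇓ u

⇓-head : {c u : Contract n} → c ⇓ u → Head u
⇓-head (done h) = h
⇓-head (unfold r) = ⇓-head r

⇓-unique : {c u v : Contract n} → c ⇓ u → c ⇓ v → u ≡ v
⇓-unique (done _) (done _) = refl
⇓-unique (done (head-node ())) (unfold _)
⇓-unique (unfold _) (done (head-node ()))
⇓-unique (unfold r) (unfold s) = ⇓-unique r s

⇓⇒↠ : {c u : Contract n} → c ⇓ u → c ↠ u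
⇓⇒↠ (done _) = ↠-refl _
⇓⇒↠ (unfold r) = ↠-unfold (⇓⇒↠ r)

⇓⇒≈ : {c u : Contract n} → c ⇓ u → c ≈ u
⇓⇒≈ (done _) = ≈-refl
⇓⇒≈ (unfold {b} r) = ≈-trans ≈-unfold (≈-trans (≡⇒≈ (unfoldBody≡inst b)) (⇓⇒≈ r))

⇓-WF : {c u : Contract n} → c ⇓ u → WF c → WF u
⇓-WF (done _) w = w
⇓-WF (unfold r) w = ⇓-WF r (WF-unfold w)

⇓-∈ : {XS : List (Contract n)} → Closed XS → ∀ {c u} → c ⇓ u → c ∈ XS → u ∈ XS
⇓-∈ cl (done _) c∈ = c∈
⇓-∈ cl (unfold r) c∈ = ⇓-∈ cl r (cl c∈ unfold)

⇓-sub : (s : Fin n → Contract m) {c u : Contract n} → c ⇓ u → sub s c ⇓ sub s u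
⇓-sub s (done head-𝟏) = done head-𝟏
⇓-sub s (done (head-node nc)) = done (head-node (Node-sub s nc))
⇓-sub s (unfold {b} r) = unfold (subst (_⇓ _) (sub-unfold s b) (⇓-sub s r))

-- The body of a well-formed recursion is not a variable, so it has a head normal form,
-- and its instance is that of the recursion.
WF⇒⇓ : {c : Contract n} → WF c → ¬ IsVar c → ∃[ u ] c ⇓ u
WF⇒⇓ wf-𝟏 _ = 𝟏 , done head-𝟏
WF⇒⇓ (wf-Σ _) _ = _ , done (head-node (Σ-node refl))
WF⇒⇓ (wf-⊕ _) _ = _ , done (head-node ⊕-node)
WF⇒⇓ wf-var ¬v = ⊥-elim (¬v tt)
WF⇒⇓ (wf-rec ¬v w) _ = let u , r = WF⇒⇓ w ¬v in _ , unfold (⇓-sub _ r)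

WF⇒⇓₀ : {c : RContract} → WF c → ∃[ u ] c ⇓ u
WF⇒⇓₀ {c} w = WF⇒⇓ w (not-var c)
  where
  not-var : (c : RContract) → ¬ IsVar c
  not-var (var ())

head-𝟏⁻ : {u : Contract n} → Head u → u ⋈ 𝟏 → u ≡ 𝟏
head-𝟏⁻ head-𝟏 _ = refl
head-𝟏⁻ (head-node ()) (_ , ↠-𝟏 , _)
head-𝟏⁻ (head-node _) (_ , ↠-node _ () _ , ↠-𝟏)
head-𝟏⁻ (head-node ()) (_ , ↠-unfold _ , _)

head-node⁻ : ∀ {u d : Contract n} {k L} → Head u → Node d k L → u ⋈ d →
  ∃[ K ] (Node u k K × Match _⋈_ K L)
head-node⁻ hu nd (_ , r , ↠-unfold _) with nd
... | ()
head-node⁻ head-𝟏 nd (_ , ↠-𝟏 , ↠-node _ () _)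
head-node⁻ hu nd (_ , ↠-node nu ne (fw , bw) , ↠-node nd′ ne′ (fw′ , bw′))
  with refl , refl ← Node-unique nd nd′ | refl , refl ← Node-unique ne ne′ =
  _ , nu ,
  ( (λ c∈ → let e , e∈ , r = fw c∈ ; d , d∈ , s = bw′ e∈ in d , d∈ , e , r , s)
  , (λ d∈ → let e , e∈ , s = fw′ d∈ ; c , c∈ , r = bw e∈ in c , c∈ , e , r , s))
head-node⁻ (head-node ()) nd (_ , ↠-unfold _ , _)

-- The summands of u read as an input or retractable output, and as an internal choice;
-- empty if u is not of that form.
branches : Pol → Contract n → Choice n
branches inp (Σ⟨ inp ⟩ L) = L
branches out (Σ⟨ out ⟩ L) = L
branches out (⊕ (x ∷ [])) = x ∷ []
branches _ _ = []

internals : Contract n → Choice n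
internals (⊕ L) = L
internals (Σ⟨ out ⟩ (x ∷ [])) = x ∷ []
internals _ = []

branches-node : ∀ p {u : Contract n} {x} → x ∈ branches p u → ∃[ k ] Node u k (branches p u)
branches-node inp {Σ⟨ inp ⟩ L} _ = _ , Σ-node refl
branches-node out {Σ⟨ out ⟩ L} _ = _ , Σ-node refl
branches-node out {⊕ (_ ∷ [])} _ = _ , ⊕-node

branches-≈ : ∀ p {u : Contract n} {x} → x ∈ branches p u → u ≈ Σ⟨ p ⟩ (branches p u)
branches-≈ inp {Σ⟨ inp ⟩ L} _ = ≈-refl
branches-≈ out {Σ⟨ out ⟩ L} _ = ≈-refl
branches-≈ out {⊕ (_ ∷ [])} _ = ≈-sym ≈-unary

internals-node : {u : Contract n} → NonEmpty (internals u) → Node u internal (internals u)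
internals-node {u = ⊕ _} _ = ⊕-node
internals-node {u = Σ⟨ out ⟩ (_ ∷ [])} _ = Σ-node refl

internals-≈ : {u : Contract n} → NonEmpty (internals u) → u ≈ ⊕ (internals u)
internals-≈ ne = Node-≈ (internals-node ne)

nonEmpty? : (L : List A) → Dec (NonEmpty L)
nonEmpty? [] = no λ ()
nonEmpty? (_ ∷ _) = yes nonEmpty

branches-input : ∀ {u : Contract n} {L} → Node u input L → branches inp u ≡ L
branches-input (Σ-node {inp} _) = refl
branches-input (Σ-node {out} {[]} ())
branches-input (Σ-node {out} {_ ∷ []} ())
branches-input (Σ-node {out} {_ ∷ _ ∷ _} ())

branches-output : ∀ {u : Contract n} {L} → Node u output L → branches out u ≡ L
branches-output (Σ-node {out} _) = refl

branches-unary : ∀ {u : Contract n} {x} → Node u internal (x ∷ []) → branches out u ≡ x ∷ []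
branches-unary (Σ-node {out} _) = refl
branches-unary ⊕-node = refl

internals-internal : ∀ {u : Contract n} {L} → Node u internal L → internals u ≡ L
internals-internal ⊕-node = refl
internals-internal (Σ-node {out} {_ ∷ []} _) = refl

Match-unary : ∀ {X : Contract n → Contract n → Set} {L x} → WFChoice L → Match X L (x ∷ []) →
  ∃[ y ] L ≡ y ∷ []
Match-unary {L = []} (wfChoice () _ _)
Match-unary {L = y ∷ []} _ _ = y , refl
Match-unary {L = y ∷ z ∷ L} (wfChoice _ (y∉ AllPairs.∷ _) _) (fw , _)
  with fw (here refl) | fw (there (here refl))
... | _ , here refl , _ | _ , here refl , _ = ⊥-elim (label∉ {L = z ∷ L} y∉ (here refl) refl)

-- A unary output sum has kind `internal`, so `u` may then be an unretractable choice. Distinct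
-- names make that choice unary too, since `Match` alone would allow copies of the summand, and
-- `branches out` reads it as a sum.
branches-complete : ∀ p {u : Contract n} {L} → Head u → WF u → u ⋈ Σ⟨ p ⟩ L →
  ∀ {a c} → (a , c) ∈ L → ∃[ d ] ((a , d) ∈ branches p u × d ⋈ c)
branches-complete p {L = L} hu wu j c∈ with head-node⁻ hu (Σ-node refl) j
branches-complete inp hu wu j c∈ | K , nu , _ , bw
  rewrite branches-input nu = bw c∈
branches-complete out {L = x ∷ []} hu wu j c∈ | K , nu , mt@(_ , bw)
  with _ , refl ← Match-unary (WF-node nu wu) mt rewrite branches-unary nu = bw c∈
branches-complete out {L = x ∷ y ∷ L} hu wu j c∈ | K , nu , _ , bw
  rewrite branches-output nu = bw c∈

internals-complete : ∀ {u : Contract n} {L} → Head u → WF u → u ⋈ ⊕ L →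
  NonEmpty (internals u) × Match _⋈_ (internals u) L
internals-complete hu wu j with head-node⁻ hu ⊕-node j
... | K , nu , mt with wfChoice ne _ _ ← WF-node nu wu
  rewrite internals-internal nu = ne , mt

-- Derivations on head normal forms

infix 3 _⊢_⊣_

-- A rule of `_▷_⊣_` may apply through infinitely many representatives `L` and `R`. Here they are
-- read off the unique head normal forms, so each conclusion has finitely many candidate premises.
data _⊢_⊣_ : Ctx → RContract → RContract → Set where
  ax : ∀ {Γ ρ σ} → ρ ⇓ 𝟏 → Γ ⊢ ρ ⊣ σ
  hyp : ∀ {Γ ρ σ} → Any.Any (λ h → ρ ≈ proj₁ h × σ ≈ proj₂ h) Γ → Γ ⊢ ρ ⊣ σ
  sync : ∀ {Γ ρ σ u v} → ρ ⇓ u → σ ⇓ v → ∀ p {a ρ₁ σ₁} →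
    (a , ρ₁) ∈ branches p u → (a , σ₁) ∈ branches (dual p) v →
    (ρ , σ) ∷ Γ ⊢ ρ₁ ⊣ σ₁ → Γ ⊢ ρ ⊣ σ
  select : ∀ {Γ ρ σ u v} → ρ ⇓ u → σ ⇓ v → NonEmpty (internals u) →
    (∀ {a c} → (a , c) ∈ internals u → ∃[ d ] ((a , d) ∈ branches inp v × ((ρ , σ) ∷ Γ ⊢ c ⊣ d))) →
    Γ ⊢ ρ ⊣ σ
  offer : ∀ {Γ ρ σ u v} → ρ ⇓ u → σ ⇓ v → NonEmpty (internals v) →
    (∀ {a c} → (a , c) ∈ internals v → ∃[ d ] ((a , d) ∈ branches inp u × ((ρ , σ) ∷ Γ ⊢ c ⊣ d))) →
    Γ ⊢ ρ ⊣ σ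

first : {L : List A} → NonEmpty L → ∃[ x ] x ∈ L
first nonEmpty = _ , here refl

⊢⇒▷ : ∀ {Γ ρ σ} → Γ ⊢ ρ ⊣ σ → Γ ▷ ρ ⊣ σ
⊢⇒▷ (ax r) = Ax (⇓⇒≈ r)
⊢⇒▷ (hyp h) = let _ , h∈ , e , f = find h in Hyp h∈ e f
⊢⇒▷ (sync r s p ρ∈ σ∈ D) = R++
  (≈-trans (⇓⇒≈ r) (branches-≈ p ρ∈)) (≈-trans (⇓⇒≈ s) (branches-≈ (dual p) σ∈)) ρ∈ σ∈ (⊢⇒▷ D)
⊢⇒▷ (select r s ne f) = R⊕+
  (≈-trans (⇓⇒≈ r) (internals-≈ ne))
  -- `v` is an input by the partner of the first summand, which exists since the internal choice is
  -- non-empty.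
  (≈-trans (⇓⇒≈ s) (let _ , c∈ = first ne ; _ , d∈ , _ = f c∈ in branches-≈ inp d∈))
  (All.tabulate λ c∈ → let d , d∈ , D = f c∈ in d , d∈ , ⊢⇒▷ D)
⊢⇒▷ (offer r s ne f) = R+⊕
  (≈-trans (⇓⇒≈ r) (let _ , c∈ = first ne ; _ , d∈ , _ = f c∈ in branches-≈ inp d∈))
  (≈-trans (⇓⇒≈ s) (internals-≈ ne))
  (All.tabulate λ c∈ → let d , d∈ , D = f c∈ in d , d∈ , ⊢⇒▷ D)

-- Transport of derivations to head normal forms

WFCtx : Ctx → Set
WFCtx = All (λ h → WF (proj₁ h) × WF (proj₂ h))

infix 4 _≲_

_≲_ : Ctx → Ctx → Set
Γ ≲ Γ′ = ∀ {ρ σ} → (ρ , σ) ∈ Γ → ∃[ ρ′ ] ∃[ σ′ ] ((ρ′ , σ′) ∈ Γ′ × ρ ⋈ ρ′ × σ ⋈ σ′)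

≲-extend : ∀ {Γ Γ′ ρ σ ρ′ σ′} → ρ ⋈ ρ′ → σ ⋈ σ′ → Γ ≲ Γ′ → ((ρ , σ) ∷ Γ) ≲ ((ρ′ , σ′) ∷ Γ′)
≲-extend j j′ le (here refl) = _ , _ , here refl , j , j′
≲-extend j j′ le (there h∈) = let _ , _ , h∈′ , i , i′ = le h∈ in _ , _ , there h∈′ , i , i′

Transfers : Ctx → RContract → RContract → Set
Transfers Γ ρ σ = ∀ {Γ′ ρ′ σ′} → WFCtx Γ′ → WF ρ′ → WF σ′ →
  Γ ≲ Γ′ → ρ ⋈ ρ′ → σ ⋈ σ′ → Γ′ ⊢ ρ′ ⊣ σ′

normal : {c c′ d u : RContract} → c′ ⇓ u → c ⋈ c′ → c ≈ d → u ⋈ d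
normal r j e = ⋈-trans (⋈-sym (↠⇒⋈ (⇓⇒↠ r))) (⋈-trans (⋈-sym j) (≈⇒⋈ e))

branch-WF : ∀ p {c u : RContract} {a d} → c ⇓ u → WF c → (a , d) ∈ branches p u → WF d
branch-WF p r w d∈ = WF-∈ (WF-node (proj₂ (branches-node p d∈)) (⇓-WF r w)) d∈

internal-WF : ∀ {c u : RContract} {a d} → NonEmpty (internals u) → c ⇓ u → WF c →
  (a , d) ∈ internals u → WF d
internal-WF ne r w d∈ = WF-∈ (WF-node (internals-node ne) (⇓-WF r w)) d∈

-- A derivation may pass through ill-formed contracts, since equivalence does not preserve WF;
-- it is therefore transported along joinability to well-formed ones.
mutual
  ▷⇒⊢ : ∀ {Γ ρ σ} → Γ ▷ ρ ⊣ σ → Transfers Γ ρ σ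
  ▷⇒⊢ (Ax e) wΓ wρ wσ le j j′ =
    let u , r = WF⇒⇓₀ wρ
    in ax (subst (_ ⇓_) (head-𝟏⁻ (⇓-head r) (normal r j e)) r)
  ▷⇒⊢ (Hyp h∈ e f) wΓ wρ wσ le j j′ =
    let _ , _ , h∈′ , i , i′ = le h∈ ; w , w′ = All.lookup wΓ h∈′
    -- Contract and hypothesis are both well-formed, so joinability gives back `_≈_`, whatever lies
    -- in between.
    in hyp (lose h∈′ ( ⋈⇒≈ _ _ wρ w (⋈-trans (⋈-sym j) (⋈-trans (≈⇒⋈ e) i))
                     , ⋈⇒≈ _ _ wσ w′ (⋈-trans (⋈-sym j′) (⋈-trans (≈⇒⋈ f) i′))))
  ▷⇒⊢ (R++ {p = p} e f ρ∈ σ∈ D) wΓ wρ wσ le j j′ =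
    let u , r = WF⇒⇓₀ wρ ; v , s = WF⇒⇓₀ wσ
        _ , ρ∈′ , i = branches-complete p (⇓-head r) (⇓-WF r wρ) (normal r j e) ρ∈
        _ , σ∈′ , i′ = branches-complete (dual p) (⇓-head s) (⇓-WF s wσ) (normal s j′ f) σ∈
    in sync r s p ρ∈′ σ∈′ (▷⇒⊢ D ((wρ , wσ) ∷ wΓ)
         (branch-WF p r wρ ρ∈′) (branch-WF (dual p) s wσ σ∈′)
         (≲-extend j j′ le) (⋈-sym i) (⋈-sym i′))
  ▷⇒⊢ (R⊕+ e f Ds) wΓ wρ wσ le j j′ =
    let u , r = WF⇒⇓₀ wρ ; v , s = WF⇒⇓₀ wσ
        ne , fw , _ = internals-complete (⇓-head r) (⇓-WF r wρ) (normal r j e)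
    -- A summand of the head normal form is traced to one of the rule's list, then to its partner in
    -- `R`, then to the head normal form of the other side.
    in select r s ne λ c∈ →
      let _ , x∈ , i = fw c∈
          _ , y∈ , D = ▷⇒⊢-all Ds x∈
          d , d∈ , i′ = branches-complete inp (⇓-head s) (⇓-WF s wσ) (normal s j′ f) y∈
      in d , d∈ , D ((wρ , wσ) ∷ wΓ) (internal-WF ne r wρ c∈) (branch-WF inp s wσ d∈)
           (≲-extend j j′ le) (⋈-sym i) (⋈-sym i′)
  ▷⇒⊢ (R+⊕ e f Ds) wΓ wρ wσ le j j′ =
    let u , r = WF⇒⇓₀ wρ ; v , s = WF⇒⇓₀ wσ
        ne , fw , _ = internals-complete (⇓-head s) (⇓-WF s wσ) (normal s j′ f)
    in offer r s ne λ c∈ →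
      let _ , x∈ , i = fw c∈
          _ , y∈ , D = ▷⇒⊢-all Ds x∈
          d , d∈ , i′ = branches-complete inp (⇓-head r) (⇓-WF r wρ) (normal r j e) y∈
      in d , d∈ , D ((wρ , wσ) ∷ wΓ) (internal-WF ne s wσ c∈) (branch-WF inp r wρ d∈)
           (≲-extend j j′ le) (⋈-sym i) (⋈-sym i′)

  ▷⇒⊢-all : ∀ {Γ} {L R : Choice 0} →
    All (λ x → ∃[ d ] (((proj₁ x , d) ∈ R) × (Γ ▷ proj₂ x ⊣ d))) L →
    ∀ {a c} → (a , c) ∈ L → ∃[ d ] ((a , d) ∈ R × Transfers Γ c d)
  ▷⇒⊢-all ((d , d∈ , D) ∷ _) (here refl) = d , d∈ , ▷⇒⊢ D
  ▷⇒⊢-all (_ ∷ Ds) (there c∈) = ▷⇒⊢-all Ds c∈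

-- Every rule other than ax and hyp assumes its conclusion. On a finite set of contracts closed
-- under reachability this can happen only finitely often before hyp applies. Rule R+⊕ exchanges
-- the two sides, so the same set serves for both.

module _ {XS : List RContract} (cl : Closed XS) where

  private
    U = cartesianProduct XS XS

    _∈?_ : (h : RContract × RContract) (Γ : Ctx) → Dec (h ∈ Γ)
    h ∈? Γ = Any.any? (≡-dec _≟_ _≟_ h) Γ

    unassumed? : ∀ Γ h → Dec (h ∉ Γ)
    unassumed? Γ h = ¬? (h ∈? Γ)

    measure : Ctx → ℕ
    measure Γ = length (filter (unassumed? Γ) U)

    measure-< : ∀ {Γ h} → h ∈ U → h ∉ Γ → measure (h ∷ Γ) < measure Γ
    measure-< {Γ} {h} h∈ h∉
      with filter-length-< (unassumed? (h ∷ Γ)) (unassumed? Γ) (λ x∉ → x∉ ∘ there) U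
    ... | inj₁ eq = ⊥-elim (eq h∈ h∉ (here refl))
    ... | inj₂ lt = lt

    hyp? : ∀ {Γ ρ σ} → WFCtx Γ → WF ρ → WF σ →
      Dec (Any.Any (λ h → ρ ≈ proj₁ h × σ ≈ proj₂ h) Γ)
    hyp? [] wρ wσ = no λ ()
    hyp? ((w , w′) ∷ wΓ) wρ wσ =
      map′ Any.fromSum Any.toSum ((≈? _ _ wρ w ×-dec ≈? _ _ wσ w′) ⊎-dec hyp? wΓ wρ wσ)

    branch-∈ : ∀ p {c u a d} → c ⇓ u → c ∈ XS → (a , d) ∈ branches p u → d ∈ XS
    branch-∈ p r c∈ d∈ = cl (⇓-∈ cl r c∈) (arg (proj₂ (branches-node p d∈)) d∈)

    internal-∈ : ∀ {c u a d} → NonEmpty (internals u) → c ⇓ u → c ∈ XS → (a , d) ∈ internals u → d ∈ XS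
    internal-∈ ne r c∈ d∈ = cl (⇓-∈ cl r c∈) (arg (internals-node ne) d∈)

  ⊢? : ∀ k {Γ ρ σ} → measure Γ ≤ k → WFCtx Γ → WF ρ → WF σ → ρ ∈ XS → σ ∈ XS → Dec (Γ ⊢ ρ ⊣ σ)
  ⊢? k {Γ} {ρ} {σ} le wΓ wρ wσ ρ∈ σ∈ with hyp? wΓ wρ wσ
  ... | yes h = yes (hyp h)
  -- A pair to which `hyp` does not apply is in particular not literally in `Γ`; assuming it lowers
  -- the measure, so the bound `k` cannot be zero.
  ... | no ¬h with k | ℕ.≤-trans (measure-< (∈-cartesianProduct⁺ ρ∈ σ∈)
                           (λ h∈ → ¬h (lose h∈ (≈-refl , ≈-refl)))) le
  ... | suc k | s≤s le′ with WF⇒⇓₀ wρ | WF⇒⇓₀ wσ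
  ... | u , r | v , s = map′ to from
    (u ≟ 𝟏 ⊎-dec sync? inp ⊎-dec sync? out ⊎-dec
      choice? ρ∈ wρ r σ∈ wσ s ⊎-dec choice? σ∈ wσ s ρ∈ wρ r)
    where
    Premise : RContract → RContract → Set
    Premise ρ₁ σ₁ = (ρ , σ) ∷ Γ ⊢ ρ₁ ⊣ σ₁

    premise? : ∀ {ρ₁ σ₁} → WF ρ₁ → WF σ₁ → ρ₁ ∈ XS → σ₁ ∈ XS → Dec (Premise ρ₁ σ₁)
    premise? = ⊢? k le′ ((wρ , wσ) ∷ wΓ)

    Sync : Pol → Set
    Sync p = ∃[ a ] ∃[ ρ₁ ] ((a , ρ₁) ∈ branches p u ×
      ∃[ σ₁ ] ((a , σ₁) ∈ branches (dual p) v × Premise ρ₁ σ₁))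

    sync? : ∀ p → Dec (Sync p)
    sync? p = any-summand? (branches p u) λ {a} ρ₁∈ → summand? a (branches (dual p) v) λ σ₁∈ →
      premise? (branch-WF p r wρ ρ₁∈) (branch-WF (dual p) s wσ σ₁∈)
        (branch-∈ p r ρ∈ ρ₁∈) (branch-∈ (dual p) s σ∈ σ₁∈)

    Choose : RContract → RContract → Set
    Choose x y = NonEmpty (internals x) ×
      (∀ {a c} → (a , c) ∈ internals x → ∃[ d ] ((a , d) ∈ branches inp y × Premise c d))

    choice? : ∀ {c d x y} → c ∈ XS → WF c → c ⇓ x → d ∈ XS → WF d → d ⇓ y → Dec (Choose x y)
    choice? {x = x} {y} c∈ wc cx d∈ wd dy with nonEmpty? (internals x)
    ... | no ¬ne = no (¬ne ∘ proj₁)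
    ... | yes ne with all-summands? {P = λ a c → ∃[ d ] ((a , d) ∈ branches inp y × Premise c d)}
                        (internals x) (λ {a} c₁∈ → summand? a (branches inp y) λ d₁∈ →
                          premise? (internal-WF ne cx wc c₁∈) (branch-WF inp dy wd d₁∈)
                            (internal-∈ ne cx c∈ c₁∈) (branch-∈ inp dy d∈ d₁∈))
    ... | yes f = yes (ne , f)
    ... | no ¬f = no λ { (_ , f) → ¬f f }

    to : u ≡ 𝟏 ⊎ Sync inp ⊎ Sync out ⊎ Choose u v ⊎ Choose v u → Γ ⊢ ρ ⊣ σ
    to (inj₁ refl) = ax r
    to (inj₂ (inj₁ (_ , _ , ρ₁∈ , _ , σ₁∈ , D))) = sync r s inp ρ₁∈ σ₁∈ D
    to (inj₂ (inj₂ (inj₁ (_ , _ , ρ₁∈ , _ , σ₁∈ , D)))) = sync r s out ρ₁∈ σ₁∈ D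
    to (inj₂ (inj₂ (inj₂ (inj₁ (ne , f))))) = select r s ne f
    to (inj₂ (inj₂ (inj₂ (inj₂ (ne , f))))) = offer r s ne f

    from : Γ ⊢ ρ ⊣ σ → u ≡ 𝟏 ⊎ Sync inp ⊎ Sync out ⊎ Choose u v ⊎ Choose v u
    from (ax r′) = inj₁ (⇓-unique r r′)
    from (hyp h) = ⊥-elim (¬h h)
    from (sync r′ s′ p ρ₁∈ σ₁∈ D) with refl ← ⇓-unique r r′ | refl ← ⇓-unique s s′ | p
    ... | inp = inj₂ (inj₁ (_ , _ , ρ₁∈ , _ , σ₁∈ , D))
    ... | out = inj₂ (inj₂ (inj₁ (_ , _ , ρ₁∈ , _ , σ₁∈ , D)))
    from (select r′ s′ ne f) with refl ← ⇓-unique r r′ | refl ← ⇓-unique s s′ =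
      inj₂ (inj₂ (inj₂ (inj₁ (ne , f))))
    from (offer r′ s′ ne f) with refl ← ⇓-unique r r′ | refl ← ⇓-unique s s′ =
      inj₂ (inj₂ (inj₂ (inj₂ (ne , f))))

mainTheorem1 : (Γ : Ctx) (ρ σ : RContract) →
    All (λ h → WF (proj₁ h) × WF (proj₂ h)) Γ → WF ρ → WF σ →
    Dec (Γ ▷ ρ ⊣ σ)
mainTheorem1 Γ ρ σ wΓ wρ wσ = map′ ⊢⇒▷
  (λ D → ▷⇒⊢ D wΓ wρ wσ (λ h∈ → _ , _ , h∈ , ⋈-refl , ⋈-refl) ⋈-refl ⋈-refl)
  (⊢? closed _ ℕ.≤-refl wΓ wρ wσ (∈-++⁺ˡ (∈-reachable ρ)) (∈-++⁺ʳ (reachable ρ) (∈-reachable σ)))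
  where
  closed : Closed (reachable ρ ++ reachable σ)
  closed c∈ st with ∈-++⁻ (reachable ρ) c∈
  ... | inj₁ c∈ = ∈-++⁺ˡ (reachable-closed ρ c∈ st)
  ... | inj₂ c∈ = ∈-++⁺ʳ (reachable ρ) (reachable-closed σ c∈ st)
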